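{- Let $m \geq 2$ be an integer, then $$ \mathsf{D}^{(3)} (\{ -m,\dots,m\}^2) = 4m^2 -q(m). $$ Moreover, up to symmetries, there is only one minimal zero-sum sequence over $\{ -m,\dots,m\}^2$ having a support of size $3$ and maximum length, namely $\begin{pmatrix} m \\ m \end{pmatrix}$ repeated $q(m)(m -1) + m$ times, $\begin{pmatrix} -m \\ m-1 \end{pmatrix}$ repeated $2m^2 - mq(m)$ times, and $\begin{pmatrix} m-q(m) \\ -m \end{pmatrix}$ repeated $2m^2-m$ times.
   Context: For a subset $X$ of an abelian group, a sequence is an unordered multiset of elements of $X$; it is a minimal zero-sum sequence if its elements sum to $0$ and no non-empty proper subsequence sums to $0$. $\mathsf{D}^{(k)}(X)$ denotes the maximal length of a minimal zero-sum sequence over $X$ whose support (set of distinct elements) has size exactly $k$. $\{ -m,\dots,m\}$ denotes the set of integers $i$ with $-m\le i\le m$. For an integer $m\ge 2$, $q(m)$ denotes the smallest prime not dividing $m$. Symmetries are those of the square, generated by $(x,y)\mapsto(-x,y)$ and $(x,y)\mapsto(y,x)$. -}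

module Defs where

open import Data.Bool using (Bool; true; false; if_then_else_)
open import Data.Nat as ℕ using (ℕ; _∸_)
open import Data.Nat.Divisibility using (_∣_)
open import Data.Nat.Primality using (Prime)
open import Data.Integer as ℤ using (ℤ; +_; -_)
import Data.Integer.Properties as ℤP
open import Data.Product using (_×_; _,_; Σ; ∃)
open import Data.Product.Properties using (≡-dec)
open import Data.List using (List; []; _∷_; length; deduplicate; replicate; _++_)
open import Data.List.Relation.Unary.All using (All)
open import Data.List.Relation.Binary.Sublist.Propositional using (_⊆_)
open import Relation.Binary.PropositionalEquality using (_≡_)
open import Relation.Nullary using (¬_)

Pt : Set
Pt = ℤ × ℤ

_≟Pt_ : (a b : Pt) → Relation.Nullary.Dec (a ≡ b)
_≟Pt_ = ≡-dec ℤP._≟_ ℤP._≟_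

0Pt : Pt
0Pt = (+ 0 , + 0)

_+Pt_ : Pt → Pt → Pt
(a , b) +Pt (c , d) = (a ℤ.+ c , b ℤ.+ d)

-- A sequence over ℤ² is represented by a list (order is irrelevant for all
-- notions below). Its sum:
σ : List Pt → Pt
σ [] = 0Pt
σ (x ∷ xs) = x +Pt σ xs

InBox : ℕ → Pt → Set
InBox m (x , y) = ((- (+ m)) ℤ.≤ x × x ℤ.≤ + m) × ((- (+ m)) ℤ.≤ y × y ℤ.≤ + m)

supportSize : List Pt → ℕ
supportSize S = length (deduplicate _≟Pt_ S)

-- subsequences = sub-multisets = sublists (choice of a subset of positions)
MinimalZeroSum : List Pt → Set
MinimalZeroSum S =
  σ S ≡ 0Pt × ¬ (S ≡ []) ×
  (∀ (T : List Pt) → T ⊆ S → ¬ (T ≡ []) → length T ℕ.< length S → ¬ (σ T ≡ 0Pt))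

Admissible : ℕ → List Pt → Set
Admissible m S = All (InBox m) S × MinimalZeroSum S × supportSize S ≡ 3

IsQ : ℕ → ℕ → Set
IsQ m p = Prime p × ¬ (p ∣ m) × (∀ r → Prime r → ¬ (r ∣ m) → p ℕ.≤ r)

-- symmetries of the square: (swap?, negate first?, negate second?)
-- (x,y) ↦ optionally swap, then optionally negate each coordinate; these are
-- exactly the 8 elements of the group generated by (x,y)↦(-x,y), (x,y)↦(y,x).
Sym : Set
Sym = Bool × Bool × Bool

negIf : Bool → ℤ → ℤ
negIf true z = - z
negIf false z = z

act : Sym → Pt → Pt
act (s , a , b) (x , y) =
  if s then (negIf a y , negIf b x) else (negIf a x , negIf b y)

extremal : ℕ → ℕ → List Pt
extremal m q =
  replicate (q ℕ.* (m ∸ 1) ℕ.+ m) (+ m , + m) ++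
  replicate (2 ℕ.* m ℕ.* m ∸ m ℕ.* q) (- (+ m) , + m ℤ.- + 1) ++
  replicate (2 ℕ.* m ℕ.* m ∸ m) (+ m ℤ.- + q , - (+ m))

{-# OPTIONS --safe #-}
module Submission where

-- A sequence with support {a, b, c} and multiplicities α, β, γ is a minimal zero-sum sequence only if
-- gcd(α, β, γ) = 1, and then Cramer's rule gives (det(b,c), det(c,a), det(a,b)) = g (α, β, γ) for some
-- integer g. If g = 0 the three points lie on a line through 0 and the length is less than 4 m.
-- Otherwise |g| times the length is twice the area of the triangle a b c. Unless the triangle touches
-- all four sides of the box, this is at most 2 m (2 m - 1), which is too small. If it does, one vertex
-- is a corner of the box, and up to symmetry the triangle is (m, m), (-m, m - v), (m - u, -m), of double
-- area 4 m² - u v. If |g| ≥ 2 the length is at most 2 m². If |g| = 1, coprimality of the determinants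
-- forces u v to be at least 2 and coprime to m, whence u v ≥ q(m), with equality only for {u, v} = {1, q(m)}.

open import Defs
open import Data.Nat using (ℕ; _≤_; _+_; _*_)
open import Data.Product using (_×_; ∃)
open import Data.List using (List; length; map)
open import Data.List.Relation.Binary.Permutation.Propositional using (_↭_)
open import Relation.Binary.PropositionalEquality using (_≡_)

open import Data.Nat using (zero; suc; pred; _<_; _∸_; z≤n; s≤s; z<s; NonZero; >-nonZero; ≢-nonZero; ≢-nonZero⁻¹; nonTrivial⇒n>1)
import Data.Nat.Properties as ℕ
open import Data.Nat.Divisibility using (_∣_; divides; _∣0; ∣-refl; ∣-reflexive; ∣-trans; ∣⇒≤; ∣m+n∣m⇒∣n; ∣1⇒≡1; m∣m*n; n∣m*n; ∣m⇒∣m*n)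
open import Data.Nat.GCD using (gcd; gcd[m,n]∣m; gcd[m,n]∣n; gcd-greatest; c*gcd[m,n]≡gcd[cm,cn])
open import Data.Nat.ListAction using (product)
open import Data.Nat.Primality using (Prime; prime⇒nonTrivial; prime⇒irreducible; prime⇒nonZero; euclidsLemma)
open import Data.Nat.Primality.Factorisation using (factorise)
import Data.Nat.Tactic.RingSolver as ℕSolver
open import Data.Integer as ℤ using (ℤ; +_; -[1+_]; 0ℤ; ∣_∣)
import Data.Integer.Properties as ℤ
import Data.Integer.Divisibility.Signed as ℤᵈ
import Data.Integer.Tactic.RingSolver as ℤSolver
import Algebra.Properties.AbelianGroup ℤ.+-0-abelianGroup as ℤ-+
open import Data.Bool using (true; false; _xor_; if_then_else_)
open import Data.Product using (_,_; ∃₂; proj₁; proj₂)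
open import Data.Sum as Sum using (_⊎_; inj₁; inj₂; [_,_]′)
open import Data.List using ([]; _∷_; _++_; replicate; filter; deduplicate)
open import Data.List.Properties using (length-++; length-replicate; length-map; filter-all; filter-reject; filter-idem; ++-identityʳ; map-replicate; map-++; map-cong; map-∘)
open import Data.List.Relation.Unary.All as All using (All; []; _∷_)
import Data.List.Relation.Unary.All.Properties as All
open import Data.List.Relation.Unary.AllPairs using ([]; _∷_)
open import Data.List.Relation.Unary.Any using (here; there)
open import Data.List.Relation.Unary.Unique.Propositional using (Unique)
open import Data.List.Relation.Unary.Unique.DecPropositional.Properties _≟Pt_ using (deduplicate-!)
open import Data.List.Membership.Propositional using (_∈_)
open import Data.List.Membership.Propositional.Properties using (∈-++⁻; ∈-deduplicate⁺; ∈-deduplicate⁻)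
open import Data.List.Relation.Binary.Sublist.Propositional using (_⊆_; []; _∷_; _∷ʳ_)
open import Data.List.Relation.Binary.Permutation.Propositional as Perm using (↭-sym; ↭-trans; ↭-refl; ↭-reflexive)
open import Data.List.Relation.Binary.Permutation.Propositional.Properties using (↭-length; ∈-resp-↭; shift; shifts; ++⁺ˡ; ++-comm; map⁺)
open import Function using (_∘_)
open import Relation.Unary using (_∪_)
open import Relation.Nullary using (¬_; Dec; yes; no; contradiction; ¬?)
open import Relation.Binary.PropositionalEquality

-- Every competing case is discarded by comparing its loss against 4 m² with q(m). A prime divisor
-- of m + 1 does not divide m, so q(m) ≤ m + 1. A triangle missing a side of the box loses at least
-- 2 m, and m + 1 < 2 m is exactly m ≥ 2. A corner exists by pigeonhole: opposite sides are
-- disjoint, so two of the three vertices lie on vertical sides and two on horizontal sides, and one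
-- vertex is in both pairs. The opposite corner cannot be a vertex too, because the two would form a
-- zero-sum pair. Hence the other two vertices take the remaining two sides, one each, which gives
-- the parameters u and v. The determinants at the corner are m (u + v) - u v, m (2 m - u) and m (2
-- m - v): modulo m only u v survives, so each common prime factor of u v and m divides all three.
-- That the bound is attained needs the converse of Cramer's rule: if the three determinants are
-- positive and jointly coprime, every relation with natural coefficients is a multiple of the one
-- that they give.

-- The size of q(m)

∃-primeDivisor : ∀ {n} → 2 ≤ n → ∃ λ p → Prime p × p ∣ n
∃-primeDivisor {suc n} 2≤n with factorise (suc n)
... | record { factors = [] ; isFactorisation = eq } = contradiction eq (λ eq → ℕ.<⇒≢ 2≤n (sym eq))
... | record { factors = p ∷ ps ; isFactorisation = eq ; factorsPrime = pr ∷ _ } =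
  p , pr , subst (p ∣_) (sym eq) (m∣m*n (product ps))

prime⇒≥2 : ∀ {p} → Prime p → 2 ≤ p
prime⇒≥2 {p} pr = nonTrivial⇒n>1 p {{prime⇒nonTrivial pr}}

IsQ⇒q≤1+m : ∀ {m q} → 2 ≤ m → IsQ m q → q ≤ suc m
IsQ⇒q≤1+m {m} 2≤m (_ , _ , least) with ∃-primeDivisor (ℕ.m≤n⇒m≤1+n 2≤m)
... | p , pr , p∣1+m = ℕ.≤-trans (least p pr p∤m) (∣⇒≤ p∣1+m)
  where
  p∤m : ¬ p ∣ m
  p∤m p∣m = ℕ.<⇒≢ (prime⇒≥2 pr) (sym (∣1⇒≡1 (∣m+n∣m⇒∣n (subst (p ∣_) (ℕ.+-comm 1 m) p∣1+m) p∣m)))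

-- Minimal relations between three elements

Relation₃ : Set₁
Relation₃ = ℕ → ℕ → ℕ → Set

-- Minimality of a sequence expressed through its multiplicities alone. The relation is a parameter
-- because the argument moves between relations of points (`Null`), of integers (`Lin`) and of
-- naturals (`Balance`).
record Minimal (R : Relation₃) (α β γ : ℕ) : Set where
  field
    α>0 : 0 < α
    β>0 : 0 < β
    γ>0 : 0 < γ
    holds : R α β γ
    minimal : ∀ {i j k} → i ≤ α → j ≤ β → k ≤ γ → R i j k →
              (i ≡ 0 × j ≡ 0 × k ≡ 0) ⊎ (i ≡ α × j ≡ β × k ≡ γ)

module _ {R : Relation₃} {α β γ : ℕ} (M : Minimal R α β γ) where
  open Minimal M

  Minimal-cong : ∀ {R′} → (∀ {i j k} → R i j k → R′ i j k) → (∀ {i j k} → R′ i j k → R i j k) →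
                 Minimal R′ α β γ
  Minimal-cong to from = record
    { α>0 = α>0 ; β>0 = β>0 ; γ>0 = γ>0 ; holds = to holds
    ; minimal = λ i≤ j≤ k≤ r → minimal i≤ j≤ k≤ (from r) }

  Minimal-swap₁₂ : Minimal (λ i j k → R j i k) β α γ
  Minimal-swap₁₂ = record
    { α>0 = β>0 ; β>0 = α>0 ; γ>0 = γ>0 ; holds = holds ; minimal = λ i≤ j≤ k≤ r → flip (minimal j≤ i≤ k≤ r) }
    where
    flip : ∀ {A B C A′ B′ C′ : Set} → (A × B × C) ⊎ (A′ × B′ × C′) → (B × A × C) ⊎ (B′ × A′ × C′)
    flip (inj₁ (a , b , c)) = inj₁ (b , a , c)
    flip (inj₂ (a , b , c)) = inj₂ (b , a , c)

  Minimal-swap₂₃ : Minimal (λ i j k → R i k j) α γ β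
  Minimal-swap₂₃ = record
    { α>0 = α>0 ; β>0 = γ>0 ; γ>0 = β>0 ; holds = holds ; minimal = λ i≤ j≤ k≤ r → flip (minimal i≤ k≤ j≤ r) }
    where
    flip : ∀ {A B C A′ B′ C′ : Set} → (A × B × C) ⊎ (A′ × B′ × C′) → (A × C × B) ⊎ (A′ × C′ × B′)
    flip (inj₁ (a , b , c)) = inj₁ (a , c , b)
    flip (inj₂ (a , b , c)) = inj₂ (a , c , b)

  ¬holds-ij0 : ∀ {i j} → i ≤ α → j ≤ β → ¬ (i ≡ 0 × j ≡ 0) → ¬ R i j 0
  ¬holds-ij0 i≤α j≤β ≢0 r with minimal i≤α j≤β z≤n r
  ... | inj₁ (i≡0 , j≡0 , _) = ≢0 (i≡0 , j≡0)
  ... | inj₂ (_ , _ , 0≡γ) = ℕ.<⇒≢ γ>0 0≡γ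

record Lin (x y z : ℤ) (i j k : ℕ) : Set where
  constructor lin
  field equation : + i ℤ.* x ℤ.+ (+ j ℤ.* y ℤ.+ + k ℤ.* z) ≡ 0ℤ

record Null (a b c : Pt) (i j k : ℕ) : Set where
  constructor null
  field
    null₁ : Lin (proj₁ a) (proj₁ b) (proj₁ c) i j k
    null₂ : Lin (proj₂ a) (proj₂ b) (proj₂ c) i j k

Lin-swap₁₂ : ∀ {x y z i j k} → Lin x y z j i k → Lin y x z i j k
Lin-swap₁₂ {x} {y} {z} {i} {j} {k} (lin e) = lin (trans (lemma (+ i) (+ j) (+ k) x y z) e)
  where
  lemma : ∀ i j k x y z → i ℤ.* y ℤ.+ (j ℤ.* x ℤ.+ k ℤ.* z) ≡ j ℤ.* x ℤ.+ (i ℤ.* y ℤ.+ k ℤ.* z)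
  lemma = ℤSolver.solve-∀

Lin-swap₂₃ : ∀ {x y z i j k} → Lin x y z i k j → Lin x z y i j k
Lin-swap₂₃ {x} {y} {z} {i} {j} {k} (lin e) = lin (trans (lemma (+ i) (+ j) (+ k) x y z) e)
  where
  lemma : ∀ i j k x y z → i ℤ.* x ℤ.+ (j ℤ.* z ℤ.+ k ℤ.* y) ≡ i ℤ.* x ℤ.+ (k ℤ.* y ℤ.+ j ℤ.* z)
  lemma = ℤSolver.solve-∀

Lin-neg : ∀ {x y z i j k} → Lin x y z i j k → Lin (ℤ.- x) (ℤ.- y) (ℤ.- z) i j k
Lin-neg {x} {y} {z} {i} {j} {k} (lin e) = lin (trans (lemma (+ i) (+ j) (+ k) x y z) (cong ℤ.-_ e))
  where
  lemma : ∀ i j k x y z → i ℤ.* (ℤ.- x) ℤ.+ (j ℤ.* (ℤ.- y) ℤ.+ k ℤ.* (ℤ.- z))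
                        ≡ ℤ.- (i ℤ.* x ℤ.+ (j ℤ.* y ℤ.+ k ℤ.* z))
  lemma = ℤSolver.solve-∀

Lin-neg⁻ : ∀ {x y z i j k} → Lin (ℤ.- x) (ℤ.- y) (ℤ.- z) i j k → Lin x y z i j k
Lin-neg⁻ {x} {y} {z} e =
  subst₂ (λ x y → Lin x y _ _ _ _) (ℤ.neg-involutive x) (ℤ.neg-involutive y)
    (subst (λ z → Lin _ _ z _ _ _) (ℤ.neg-involutive z) (Lin-neg e))

Lin-*⁻ : ∀ {x y z i j k} d .{{_ : NonZero d}} → Lin x y z (i * d) (j * d) (k * d) → Lin x y z i j k
Lin-*⁻ {x} {y} {z} {i} {j} {k} d (lin e) = lin
  ([ (λ e → e) , (λ d≡0 → contradiction (ℤ.+-injective d≡0) (≢-nonZero⁻¹ d)) ]′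
    (ℤ.i*j≡0⇒i≡0∨j≡0 (+ i ℤ.* x ℤ.+ (+ j ℤ.* y ℤ.+ + k ℤ.* z)) (trans (sym eq) e)))
  where
  lemma : ∀ i j k d x y z → (i ℤ.* d) ℤ.* x ℤ.+ ((j ℤ.* d) ℤ.* y ℤ.+ (k ℤ.* d) ℤ.* z)
                          ≡ (i ℤ.* x ℤ.+ (j ℤ.* y ℤ.+ k ℤ.* z)) ℤ.* d
  lemma = ℤSolver.solve-∀
  eq : + (i * d) ℤ.* x ℤ.+ (+ (j * d) ℤ.* y ℤ.+ + (k * d) ℤ.* z)
     ≡ (+ i ℤ.* x ℤ.+ (+ j ℤ.* y ℤ.+ + k ℤ.* z)) ℤ.* + d
  eq = trans (cong₂ ℤ._+_ (cong (ℤ._* x) (ℤ.pos-* i d))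
               (cong₂ ℤ._+_ (cong (ℤ._* y) (ℤ.pos-* j d)) (cong (ℤ._* z) (ℤ.pos-* k d))))
             (lemma (+ i) (+ j) (+ k) (+ d) x y z)

Null-swap₁₂ : ∀ {a b c i j k} → Null a b c j i k → Null b a c i j k
Null-swap₁₂ (null e₁ e₂) = null (Lin-swap₁₂ e₁) (Lin-swap₁₂ e₂)

Null-swap₂₃ : ∀ {a b c i j k} → Null a b c i k j → Null a c b i j k
Null-swap₂₃ (null e₁ e₂) = null (Lin-swap₂₃ e₁) (Lin-swap₂₃ e₂)

Null-rotate : ∀ {a b c i j k} → Null a b c i j k → Null b c a j k i
Null-rotate e = Null-swap₂₃ (Null-swap₁₂ e)

Null-*⁻ : ∀ {a b c i j k} d .{{_ : NonZero d}} → Null a b c (i * d) (j * d) (k * d) → Null a b c i j k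
Null-*⁻ d (null e₁ e₂) = null (Lin-*⁻ d e₁) (Lin-*⁻ d e₂)

-- Joint, not pairwise, coprimality. It ranges over arbitrary common divisors at least 2 because it
-- is contradicted with `m`, with 2 m - 1 and with primes.
Coprime₃ : ℕ → ℕ → ℕ → Set
Coprime₃ α β γ = ∀ {d} → 2 ≤ d → d ∣ α → d ∣ β → ¬ d ∣ γ

-- Dividing all multiplicities by a common factor leaves a smaller relation that is not empty.
Null-minimal⇒coprime : ∀ {a b c α β γ} → Minimal (Null a b c) α β γ → Coprime₃ α β γ
Null-minimal⇒coprime M {d} 2≤d (divides i refl) (divides j refl) (divides k refl)
  with Minimal.minimal M {i} {j} {k} (≤d i) (≤d j) (≤d k)
         (Null-*⁻ d (Minimal.holds M))
  where
  instance _ = >-nonZero (ℕ.<-trans z<s 2≤d)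
  ≤d : ∀ n → n ≤ n * d
  ≤d n = ℕ.m≤m*n n d
... | inj₁ (refl , _) = ℕ.<-irrefl refl (Minimal.α>0 M)
... | inj₂ (i≡i*d , _) = ℕ.<⇒≢ (ℕ.m<m*n i d {{i≢0}} 2≤d) i≡i*d
  where
  i≢0 = ℕ.m*n≢0⇒m≢0 i {{>-nonZero (Minimal.α>0 M)}}

-- `m` divides gcd(nα, nβ, nγ) = n gcd(α, β, γ) = n. This makes the scale an integer, and later
-- shows that the extremal sequence is minimal.
coprime-divisor₃ : ∀ {α β γ n m} → 0 < γ → Coprime₃ α β γ → m ∣ n * α → m ∣ n * β → m ∣ n * γ → m ∣ n
coprime-divisor₃ {α} {β} {γ} {n} {m} γ>0 coprime m∣nα m∣nβ m∣nγ = subst (m ∣_) n*g≡n m∣n*g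
  where
  g = gcd (gcd α β) γ
  m∣n*g : m ∣ n * g
  m∣n*g rewrite c*gcd[m,n]≡gcd[cm,cn] n (gcd α β) γ | c*gcd[m,n]≡gcd[cm,cn] n α β =
    gcd-greatest (gcd-greatest m∣nα m∣nβ) m∣nγ
  g≤1 : ¬ 2 ≤ g
  g≤1 2≤g = coprime 2≤g
    (∣-trans (gcd[m,n]∣m (gcd α β) γ) (gcd[m,n]∣m α β))
    (∣-trans (gcd[m,n]∣m (gcd α β) γ) (gcd[m,n]∣n α β))
    (gcd[m,n]∣n (gcd α β) γ)
  g≢0 : ∀ {g} → g ∣ γ → g ≢ 0
  g≢0 (divides q e) refl = ℕ.<⇒≢ γ>0 (sym (trans e (ℕ.*-zeroʳ q)))
  n*g≡n : n * g ≡ n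
  n*g≡n = trans (cong (n *_) (ℕ.≤-antisym (ℕ.≤-pred (ℕ.≰⇒> g≤1)) (ℕ.n≢0⇒n>0 (g≢0 (gcd[m,n]∣n (gcd α β) γ))))) (ℕ.*-identityʳ n)

-- Determinants and multiplicities

det : Pt → Pt → ℤ
det (x , y) (x′ , y′) = x ℤ.* y′ ℤ.- y ℤ.* x′

-- Apply the linear map `det _ b` to the relation i a + j b + k c = 0; the term of `b` vanishes.
cramer : ∀ {a b c i j k} → Null a b c i j k → + i ℤ.* det a b ≡ + k ℤ.* det b c
cramer {x₁ , y₁} {x₂ , y₂} {x₃ , y₃} {i} {j} {k} (null (lin ex) (lin ey)) = begin
  + i ℤ.* (x₁ ℤ.* y₂ ℤ.- y₁ ℤ.* x₂)
    ≡⟨ lemma (+ i) (+ j) (+ k) x₁ x₂ x₃ y₁ y₂ y₃ ⟩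
  + k ℤ.* (x₂ ℤ.* y₃ ℤ.- y₂ ℤ.* x₃) ℤ.+
  (y₂ ℤ.* (+ i ℤ.* x₁ ℤ.+ (+ j ℤ.* x₂ ℤ.+ + k ℤ.* x₃)) ℤ.- x₂ ℤ.* (+ i ℤ.* y₁ ℤ.+ (+ j ℤ.* y₂ ℤ.+ + k ℤ.* y₃)))
    ≡⟨ cong₂ (λ u v → + k ℤ.* (x₂ ℤ.* y₃ ℤ.- y₂ ℤ.* x₃) ℤ.+ (y₂ ℤ.* u ℤ.- x₂ ℤ.* v)) ex ey ⟩
  + k ℤ.* (x₂ ℤ.* y₃ ℤ.- y₂ ℤ.* x₃) ℤ.+ (y₂ ℤ.* 0ℤ ℤ.- x₂ ℤ.* 0ℤ)
    ≡⟨ lemma₀ (+ k ℤ.* (x₂ ℤ.* y₃ ℤ.- y₂ ℤ.* x₃)) x₂ y₂ ⟩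
  + k ℤ.* (x₂ ℤ.* y₃ ℤ.- y₂ ℤ.* x₃) ∎
  where
  open ≡-Reasoning
  lemma : ∀ i j k x₁ x₂ x₃ y₁ y₂ y₃ → i ℤ.* (x₁ ℤ.* y₂ ℤ.- y₁ ℤ.* x₂) ≡
    k ℤ.* (x₂ ℤ.* y₃ ℤ.- y₂ ℤ.* x₃) ℤ.+
    (y₂ ℤ.* (i ℤ.* x₁ ℤ.+ (j ℤ.* x₂ ℤ.+ k ℤ.* x₃)) ℤ.- x₂ ℤ.* (i ℤ.* y₁ ℤ.+ (j ℤ.* y₂ ℤ.+ k ℤ.* y₃)))
  lemma = ℤSolver.solve-∀
  lemma₀ : ∀ e x y → e ℤ.+ (y ℤ.* 0ℤ ℤ.- x ℤ.* 0ℤ) ≡ e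
  lemma₀ = ℤSolver.solve-∀

record Scaled (a b c : Pt) (α β γ : ℕ) : Set where
  field
    scale : ℤ
    det-bc : det b c ≡ scale ℤ.* + α
    det-ca : det c a ≡ scale ℤ.* + β
    det-ab : det a b ≡ scale ℤ.* + γ

-- Cramer's rule gives that γ divides α det(a,b) and β det(a,b), and trivially it divides γ
-- det(a,b). Joint coprimality yields γ ∣ det(a,b); the quotient is the scale, and cancelling γ
-- gives the other two determinants.
Null-minimal⇒scaled : ∀ {a b c α β γ} → Minimal (Null a b c) α β γ → Scaled a b c α β γ
Null-minimal⇒scaled {a} {b} {c} {α} {β} {γ} M = record
  { scale = g
  ; det-bc = cancel eα
  ; det-ca = cancel eβ
  ; det-ab = eγ }
  where
  open Minimal M
  instance _ = >-nonZero γ>0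
  eα : + α ℤ.* det a b ≡ + γ ℤ.* det b c
  eα = cramer holds
  eβ : + β ℤ.* det a b ≡ + γ ℤ.* det c a
  eβ = sym (cramer (Null-rotate (Null-rotate holds)))
  divisor : ∀ {δ D} → + δ ℤ.* det a b ≡ + γ ℤ.* D → γ ∣ ∣ det a b ∣ * δ
  divisor {δ} {D} e = divides ∣ D ∣ (begin
    ∣ det a b ∣ * δ      ≡⟨ ℕ.*-comm ∣ det a b ∣ δ ⟩
    δ * ∣ det a b ∣      ≡⟨ ℤ.abs-* (+ δ) (det a b) ⟨
    ∣ + δ ℤ.* det a b ∣  ≡⟨ cong ∣_∣ e ⟩
    ∣ + γ ℤ.* D ∣        ≡⟨ ℤ.abs-* (+ γ) D ⟩
    γ * ∣ D ∣            ≡⟨ ℕ.*-comm γ ∣ D ∣ ⟩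
    ∣ D ∣ * γ            ∎)
    where open ≡-Reasoning
  γ∣det : + γ ℤᵈ.∣ det a b
  γ∣det = ℤᵈ.∣ᵤ⇒∣ (coprime-divisor₃ γ>0 (Null-minimal⇒coprime M)
            (divisor eα) (divisor eβ) (n∣m*n ∣ det a b ∣))
  g = ℤᵈ._∣_.quotient γ∣det
  eγ : det a b ≡ g ℤ.* + γ
  eγ = ℤᵈ._∣_.equality γ∣det
  cancel : ∀ {δ D} → + δ ℤ.* det a b ≡ + γ ℤ.* D → D ≡ g ℤ.* + δ
  cancel {δ} {D} e = ℤ.*-cancelˡ-≡ (+ γ) D (g ℤ.* + δ) (begin
    + γ ℤ.* D              ≡⟨ e ⟨
    + δ ℤ.* det a b        ≡⟨ cong (+ δ ℤ.*_) eγ ⟩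
    + δ ℤ.* (g ℤ.* + γ)    ≡⟨ lemma (+ δ) g (+ γ) ⟩
    + γ ℤ.* (g ℤ.* + δ)    ∎)
    where
    open ≡-Reasoning
    lemma : ∀ d g c → d ℤ.* (g ℤ.* c) ≡ c ℤ.* (g ℤ.* d)
    lemma = ℤSolver.solve-∀

-- The area of a triangle in a rectangle

between : ∀ {x lo} w → lo ℤ.≤ x → x ℤ.≤ lo ℤ.+ + w → ∃ λ u → u ≤ w × x ≡ lo ℤ.+ + u
between {x} {lo} w lo≤x x≤hi = ∣ x ℤ.- lo ∣ , ℤ.drop‿+≤+ +u≤w , x≡
  where
  +u≡ : + ∣ x ℤ.- lo ∣ ≡ x ℤ.- lo
  +u≡ = ℤ.0≤i⇒+∣i∣≡i (ℤ.i≤j⇒0≤j-i lo≤x)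
  cancel₁ : ∀ lo w → (lo ℤ.+ w) ℤ.- lo ≡ w
  cancel₁ = ℤSolver.solve-∀
  cancel₂ : ∀ lo x → lo ℤ.+ (x ℤ.- lo) ≡ x
  cancel₂ = ℤSolver.solve-∀
  +u≤w : + ∣ x ℤ.- lo ∣ ℤ.≤ + w
  +u≤w = subst₂ ℤ._≤_ (sym +u≡) (cancel₁ lo (+ w)) (ℤ.+-monoˡ-≤ (ℤ.- lo) x≤hi)
  x≡ : x ≡ lo ℤ.+ + ∣ x ℤ.- lo ∣
  x≡ = sym (trans (cong (λ z → lo ℤ.+ z) +u≡) (cancel₂ lo x))

-- Twice the signed area of the triangle. Exchanging two vertices reverses the sign, so only the
-- absolute value is symmetric.
area : Pt → Pt → Pt → ℤ
area a b c = det b c ℤ.+ det c a ℤ.+ det a b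

area-swap₁₂ : ∀ a b c → ∣ area b a c ∣ ≡ ∣ area a b c ∣
area-swap₁₂ (x₁ , y₁) (x₂ , y₂) (x₃ , y₃) =
  trans (cong ∣_∣ (lemma x₁ x₂ x₃ y₁ y₂ y₃)) (ℤ.∣-i∣≡∣i∣ (area (x₁ , y₁) (x₂ , y₂) (x₃ , y₃)))
  where
  lemma : ∀ x₁ x₂ x₃ y₁ y₂ y₃ →
    (x₁ ℤ.* y₃ ℤ.- y₁ ℤ.* x₃) ℤ.+ (x₃ ℤ.* y₂ ℤ.- y₃ ℤ.* x₂) ℤ.+ (x₂ ℤ.* y₁ ℤ.- y₂ ℤ.* x₁) ≡
    ℤ.- ((x₂ ℤ.* y₃ ℤ.- y₂ ℤ.* x₃) ℤ.+ (x₃ ℤ.* y₁ ℤ.- y₃ ℤ.* x₁) ℤ.+ (x₁ ℤ.* y₂ ℤ.- y₁ ℤ.* x₂))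
  lemma = ℤSolver.solve-∀

area-swap₂₃ : ∀ a b c → ∣ area a c b ∣ ≡ ∣ area a b c ∣
area-swap₂₃ (x₁ , y₁) (x₂ , y₂) (x₃ , y₃) =
  trans (cong ∣_∣ (lemma x₁ x₂ x₃ y₁ y₂ y₃)) (ℤ.∣-i∣≡∣i∣ (area (x₁ , y₁) (x₂ , y₂) (x₃ , y₃)))
  where
  lemma : ∀ x₁ x₂ x₃ y₁ y₂ y₃ →
    (x₃ ℤ.* y₂ ℤ.- y₃ ℤ.* x₂) ℤ.+ (x₂ ℤ.* y₁ ℤ.- y₂ ℤ.* x₁) ℤ.+ (x₁ ℤ.* y₃ ℤ.- y₁ ℤ.* x₃) ≡
    ℤ.- ((x₂ ℤ.* y₃ ℤ.- y₂ ℤ.* x₃) ℤ.+ (x₃ ℤ.* y₁ ℤ.- y₃ ℤ.* x₁) ℤ.+ (x₁ ℤ.* y₂ ℤ.- y₁ ℤ.* x₂))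
  lemma = ℤSolver.solve-∀

∣m-n∣≤ : ∀ {m n o} → m ≤ o → n ≤ o → ∣ + m ℤ.- + n ∣ ≤ o
∣m-n∣≤ {m} {n} {o} m≤o n≤o =
  subst (λ z → ∣ z ∣ ≤ o) (sym (ℤ.m-n≡m⊖n m n)) (ℕ.≤-trans (ℤ.∣m⊝n∣≤m⊔n m n) (ℕ.⊔-lub m≤o n≤o))

module _ (x₀ y₀ : ℤ) {w h : ℕ} where

  -- With heights v, v + s, v + s + t the area is u₂ (s + t) - (u₁ t + u₃ s). Both terms lie between
  -- 0 and w (s + t) ≤ w h, hence so does the absolute value of their difference.
  area-sorted : ∀ {u₁ u₂ u₃ v₁ v₂ v₃} → u₁ ≤ w → u₂ ≤ w → u₃ ≤ w → v₁ ≤ v₂ → v₂ ≤ v₃ → v₃ ≤ h →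
    ∣ area (x₀ ℤ.+ + u₁ , y₀ ℤ.+ + v₁) (x₀ ℤ.+ + u₂ , y₀ ℤ.+ + v₂) (x₀ ℤ.+ + u₃ , y₀ ℤ.+ + v₃) ∣ ≤ w * h
  area-sorted {u₁} {u₂} {u₃} {v} u₁≤ u₂≤ u₃≤ v≤v₂ v₂≤v₃ v₃≤h
    with ℕ.m≤n⇒∃[o]m+o≡n v≤v₂ | ℕ.m≤n⇒∃[o]m+o≡n v₂≤v₃
  ... | s , refl | t , refl = subst (λ z → ∣ z ∣ ≤ w * h) (sym area≡) (∣m-n∣≤ p≤ q≤)
    where
    s+t≤h : s + t ≤ h
    s+t≤h = ℕ.≤-trans (ℕ.m≤n+m (s + t) v) (subst (_≤ h) (ℕ.+-assoc v s t) v₃≤h)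
    p≤ : u₂ * (s + t) ≤ w * h
    p≤ = ℕ.*-mono-≤ u₂≤ s+t≤h
    q≤ : u₁ * t + u₃ * s ≤ w * h
    q≤ = begin
      u₁ * t + u₃ * s  ≤⟨ ℕ.+-mono-≤ (ℕ.*-monoˡ-≤ t u₁≤) (ℕ.*-monoˡ-≤ s u₃≤) ⟩
      w * t + w * s    ≡⟨ ℕ.*-distribˡ-+ w t s ⟨
      w * (t + s)      ≡⟨ cong (w *_) (ℕ.+-comm t s) ⟩
      w * (s + t)      ≤⟨ ℕ.*-monoʳ-≤ w s+t≤h ⟩
      w * h            ∎
      where open ℕ.≤-Reasoning
    lemma : ∀ x y u₁ u₂ u₃ v s t →
      ((x ℤ.+ u₂) ℤ.* (y ℤ.+ (v ℤ.+ s ℤ.+ t)) ℤ.- (y ℤ.+ (v ℤ.+ s)) ℤ.* (x ℤ.+ u₃)) ℤ.+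
      ((x ℤ.+ u₃) ℤ.* (y ℤ.+ v) ℤ.- (y ℤ.+ (v ℤ.+ s ℤ.+ t)) ℤ.* (x ℤ.+ u₁)) ℤ.+
      ((x ℤ.+ u₁) ℤ.* (y ℤ.+ (v ℤ.+ s)) ℤ.- (y ℤ.+ v) ℤ.* (x ℤ.+ u₂)) ≡
      u₂ ℤ.* (s ℤ.+ t) ℤ.- (u₁ ℤ.* t ℤ.+ u₃ ℤ.* s)
    lemma = ℤSolver.solve-∀
    area≡ : area (x₀ ℤ.+ + u₁ , y₀ ℤ.+ + v) (x₀ ℤ.+ + u₂ , y₀ ℤ.+ + (v + s)) (x₀ ℤ.+ + u₃ , y₀ ℤ.+ + (v + s + t))
          ≡ + (u₂ * (s + t)) ℤ.- + (u₁ * t + u₃ * s)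
    area≡ = trans (lemma x₀ y₀ (+ u₁) (+ u₂) (+ u₃) (+ v) (+ s) (+ t))
      (sym (cong₂ (λ a b → a ℤ.- b) (ℤ.pos-* u₂ (s + t))
        (cong₂ ℤ._+_ (ℤ.pos-* u₁ t) (ℤ.pos-* u₃ s))))

  Inside : Pt → Set
  Inside (x , y) = (x₀ ℤ.≤ x × x ℤ.≤ x₀ ℤ.+ + w) × (y₀ ℤ.≤ y × y ℤ.≤ y₀ ℤ.+ + h)

  area≤w*h : ∀ {a b c} → Inside a → Inside b → Inside c → ∣ area a b c ∣ ≤ w * h
  area≤w*h ((l₁ , r₁) , (d₁ , t₁)) ((l₂ , r₂) , (d₂ , t₂)) ((l₃ , r₃) , (d₃ , t₃))
    with between w l₁ r₁ | between w l₂ r₂ | between w l₃ r₃ | between h d₁ t₁ | between h d₂ t₂ | between h d₃ t₃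
  ... | u₁ , u₁≤ , refl | u₂ , u₂≤ , refl | u₃ , u₃≤ , refl
      | v₁ , v₁≤ , refl | v₂ , v₂≤ , refl | v₃ , v₃≤ , refl = sort (ℕ.≤-total v₁ v₂) (ℕ.≤-total v₂ v₃) (ℕ.≤-total v₁ v₃)
    where
    A = (x₀ ℤ.+ + u₁ , y₀ ℤ.+ + v₁)
    B = (x₀ ℤ.+ + u₂ , y₀ ℤ.+ + v₂)
    C = (x₀ ℤ.+ + u₃ , y₀ ℤ.+ + v₃)
    12≡ : ∀ {a b c} → ∣ area b a c ∣ ≤ w * h → ∣ area a b c ∣ ≤ w * h
    12≡ {a} {b} {c} = subst (_≤ w * h) (area-swap₁₂ a b c)
    23≡ : ∀ {a b c} → ∣ area a c b ∣ ≤ w * h → ∣ area a b c ∣ ≤ w * h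
    23≡ {a} {b} {c} = subst (_≤ w * h) (area-swap₂₃ a b c)
    sort : v₁ ≤ v₂ ⊎ v₂ ≤ v₁ → v₂ ≤ v₃ ⊎ v₃ ≤ v₂ → v₁ ≤ v₃ ⊎ v₃ ≤ v₁ → ∣ area A B C ∣ ≤ w * h
    sort (inj₁ 12≤) (inj₁ 23≤) _ = area-sorted u₁≤ u₂≤ u₃≤ 12≤ 23≤ v₃≤
    sort (inj₁ 12≤) (inj₂ 32≤) (inj₁ 13≤) = 23≡ {A} {B} {C} (area-sorted u₁≤ u₃≤ u₂≤ 13≤ 32≤ v₂≤)
    sort (inj₁ 12≤) (inj₂ 32≤) (inj₂ 31≤) = 23≡ {A} {B} {C} (12≡ {A} {C} {B} (area-sorted u₃≤ u₁≤ u₂≤ 31≤ 12≤ v₂≤))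
    sort (inj₂ 21≤) (inj₁ 23≤) (inj₁ 13≤) = 12≡ {A} {B} {C} (area-sorted u₂≤ u₁≤ u₃≤ 21≤ 13≤ v₃≤)
    sort (inj₂ 21≤) (inj₁ 23≤) (inj₂ 31≤) = 12≡ {A} {B} {C} (23≡ {B} {A} {C} (area-sorted u₂≤ u₃≤ u₁≤ 23≤ 31≤ v₁≤))
    sort (inj₂ 21≤) (inj₂ 32≤) _ = 12≡ {A} {B} {C} (23≡ {B} {A} {C} (12≡ {B} {C} {A} (area-sorted u₃≤ u₂≤ u₁≤ 32≤ 21≤ v₁≤)))

-- Three points on a line through 0

Balance : ℕ → ℕ → ℕ → Relation₃
Balance u v w i j k = i * u + j * v ≡ k * w

module _ {u v w α β γ : ℕ} (M : Minimal (Balance u v w) α β γ) where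
  open Minimal M

  -- Otherwise w copies of u balance u copies of w, a proper part because β > 0.
  balance-weight₁< : 0 < w → α < w
  balance-weight₁< w>0 = ℕ.≰⇒> λ w≤α → nontrivial (minimal w≤α z≤n (u≤γ w≤α) (trans (ℕ.+-identityʳ (w * u)) (ℕ.*-comm w u)))
    where
    instance _ = >-nonZero w>0
    u≤γ : w ≤ α → u ≤ γ
    u≤γ w≤α = ℕ.*-cancelʳ-≤ u γ w (begin
      u * w          ≡⟨ ℕ.*-comm u w ⟩
      w * u          ≤⟨ ℕ.*-monoˡ-≤ u w≤α ⟩
      α * u          ≤⟨ ℕ.m≤m+n (α * u) (β * v) ⟩
      α * u + β * v  ≡⟨ holds ⟩
      γ * w          ∎)
      where open ℕ.≤-Reasoning
    nontrivial : ¬ ((w ≡ 0 × 0 ≡ 0 × u ≡ 0) ⊎ (w ≡ α × 0 ≡ β × u ≡ γ))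
    nontrivial (inj₁ (w≡0 , _)) = ℕ.<⇒≢ w>0 (sym w≡0)
    nontrivial (inj₂ (_ , 0≡β , _)) = ℕ.<⇒≢ β>0 0≡β

Balance-swap : ∀ {u v w α β γ} → Minimal (Balance u v w) α β γ → Minimal (Balance v u w) β α γ
Balance-swap {u} {v} M = Minimal-cong (Minimal-swap₁₂ M)
  (λ {i} {j} e → trans (ℕ.+-comm (i * v) (j * u)) e)
  (λ {i} {j} e → trans (ℕ.+-comm (j * u) (i * v)) e)

-- The `3` collects three strict bounds: α < w, β < w, and therefore γ w = α u + β v < w (u + v),
-- that is γ < u + v.
balance-length : ∀ {m u v w α β γ} → 0 < w → u ≤ m → v ≤ m → w ≤ m → Minimal (Balance u v w) α β γ →
                 α + β + γ + 3 ≤ 4 * m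
balance-length {m} {u} {v} {w} {α} {β} {γ} w>0 u≤m v≤m w≤m M = begin
  α + β + γ + 3            ≡⟨ rearrange α β γ ⟩
  suc α + suc β + suc γ    ≤⟨ ℕ.+-mono-≤ (ℕ.+-mono-≤ (ℕ.≤-trans α<w w≤m) (ℕ.≤-trans β<w w≤m)) (ℕ.≤-trans γ<u+v (ℕ.+-mono-≤ u≤m v≤m)) ⟩
  m + m + (m + m)          ≡⟨ four m ⟩
  4 * m                    ∎
  where
  open ℕ.≤-Reasoning
  open Minimal M
  rearrange : ∀ α β γ → α + β + γ + 3 ≡ suc α + suc β + suc γ
  rearrange = ℕSolver.solve-∀
  four : ∀ m → m + m + (m + m) ≡ 4 * m
  four = ℕSolver.solve-∀
  α<w = balance-weight₁< M w>0
  β<w = balance-weight₁< (Balance-swap M) w>0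
  -- A single copy of 0 would be a proper zero-sum part. Positivity of `u` keeps the bound on γ
  -- strict.
  u>0 : 0 < u
  u>0 = ℕ.n≢0⇒n>0 λ { refl → contradiction (minimal {1} {0} {0} α>0 z≤n z≤n refl)
    λ { (inj₁ (() , _)) ; (inj₂ (_ , _ , 0≡γ)) → ℕ.<⇒≢ γ>0 0≡γ } }
  γ<u+v : γ < u + v
  γ<u+v = ℕ.*-cancelʳ-< w γ (u + v) (begin-strict
    γ * w            ≡⟨ holds ⟨
    α * u + β * v    <⟨ ℕ.+-mono-<-≤ (ℕ.*-monoˡ-< u {{>-nonZero u>0}} α<w) (ℕ.*-monoˡ-≤ v (ℕ.<⇒≤ β<w)) ⟩
    w * u + w * v    ≡⟨ ℕ.*-distribˡ-+ w u v ⟨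
    w * (u + v)      ≡⟨ ℕ.*-comm w (u + v) ⟩
    (u + v) * w      ∎)

Lin⇒Balance : ∀ {u v w i j k} → Lin (+ u) (+ v) (ℤ.- + w) i j k → Balance u v w i j k
Lin⇒Balance {u} {v} {w} {i} {j} {k} (lin e) = ℤ.+-injective (begin
  + (i * u + j * v)                                    ≡⟨ cong₂ ℤ._+_ (ℤ.pos-* i u) (ℤ.pos-* j v) ⟩
  + i ℤ.* + u ℤ.+ + j ℤ.* + v                          ≡⟨ lemma (+ i) (+ j) (+ k) (+ u) (+ v) (+ w) ⟩
  (+ i ℤ.* + u ℤ.+ (+ j ℤ.* + v ℤ.+ + k ℤ.* (ℤ.- + w))) ℤ.+ + k ℤ.* + w  ≡⟨ cong (λ z → z ℤ.+ + k ℤ.* + w) e ⟩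
  0ℤ ℤ.+ + k ℤ.* + w                                   ≡⟨ ℤ.+-identityˡ (+ k ℤ.* + w) ⟩
  + k ℤ.* + w                                          ≡⟨ ℤ.pos-* k w ⟨
  + (k * w)                                            ∎)
  where
  open ≡-Reasoning
  lemma : ∀ i j k u v w → i ℤ.* u ℤ.+ j ℤ.* v ≡ (i ℤ.* u ℤ.+ (j ℤ.* v ℤ.+ k ℤ.* (ℤ.- w))) ℤ.+ k ℤ.* w
  lemma = ℤSolver.solve-∀

Balance⇒Lin : ∀ {u v w i j k} → Balance u v w i j k → Lin (+ u) (+ v) (ℤ.- + w) i j k
Balance⇒Lin {u} {v} {w} {i} {j} {k} e = lin (begin
  + i ℤ.* + u ℤ.+ (+ j ℤ.* + v ℤ.+ + k ℤ.* (ℤ.- + w))  ≡⟨ lemma (+ i) (+ j) (+ k) (+ u) (+ v) (+ w) ⟩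
  + i ℤ.* + u ℤ.+ + j ℤ.* + v ℤ.- + k ℤ.* + w          ≡⟨ cong₂ ℤ._-_ (cong₂ ℤ._+_ (ℤ.pos-* i u) (ℤ.pos-* j v)) (ℤ.pos-* k w) ⟨
  + (i * u + j * v) ℤ.- + (k * w)                      ≡⟨ cong (λ n → + n ℤ.- + (k * w)) e ⟩
  + (k * w) ℤ.- + (k * w)                              ≡⟨ ℤ.+-inverseʳ (+ (k * w)) ⟩
  0ℤ                                                   ∎)
  where
  open ≡-Reasoning
  lemma : ∀ i j k u v w → i ℤ.* u ℤ.+ (j ℤ.* v ℤ.+ k ℤ.* (ℤ.- w)) ≡ i ℤ.* u ℤ.+ j ℤ.* v ℤ.- k ℤ.* w
  lemma = ℤSolver.solve-∀

module _ {x y z α β γ} (M : Minimal (Lin x y z) α β γ) where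

  Lin-minimal-swap₁₂ : Minimal (Lin y x z) β α γ
  Lin-minimal-swap₁₂ = Minimal-cong (Minimal-swap₁₂ M) Lin-swap₁₂ Lin-swap₁₂

  Lin-minimal-swap₂₃ : Minimal (Lin x z y) α γ β
  Lin-minimal-swap₂₃ = Minimal-cong (Minimal-swap₂₃ M) Lin-swap₂₃ Lin-swap₂₃

  Lin-minimal-neg : Minimal (Lin (ℤ.- x) (ℤ.- y) (ℤ.- z)) α β γ
  Lin-minimal-neg = Minimal-cong M Lin-neg Lin-neg⁻

  Lin-minimal⇒x≢0 : x ≢ 0ℤ
  Lin-minimal⇒x≢0 refl = ¬holds-ij0 M {1} {0} (Minimal.α>0 M) z≤n (λ ()) (lin (lemma y z))
    where
    lemma : ∀ y z → + 1 ℤ.* 0ℤ ℤ.+ (0ℤ ℤ.* y ℤ.+ 0ℤ ℤ.* z) ≡ 0ℤ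
    lemma = ℤSolver.solve-∀

line-length⁺⁺⁻ : ∀ {m u v w α β γ} → u ≤ m → v ≤ m → suc w ≤ m → Minimal (Lin (+ u) (+ v) -[1+ w ]) α β γ →
                 α + β + γ + 3 ≤ 4 * m
line-length⁺⁺⁻ u≤m v≤m w≤m M = balance-length z<s u≤m v≤m w≤m (Minimal-cong M Lin⇒Balance Balance⇒Lin)

-- Since the first entry is positive, some other entry is negative. With one negative entry it is
-- moved to the last place; with two, all signs are reversed and the first entry is moved there.
line-length⁺ : ∀ {m u y z α β γ} → suc u ≤ m → ∣ y ∣ ≤ m → ∣ z ∣ ≤ m → Minimal (Lin (+ suc u) y z) α β γ →
               α + β + γ + 3 ≤ 4 * m
line-length⁺ {u = u} {+ v} {+ w} {α} {β} {γ} _ _ _ M with Minimal.holds M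
... | lin e = contradiction (ℤ.+-injective (trans +≡ e)) (≢-nonZero⁻¹ (α * suc u + (β * v + γ * w)))
  where
  instance
    _ = >-nonZero (ℕ.<-≤-trans (Minimal.α>0 M) (ℕ.≤-trans (ℕ.m≤m*n α (suc u)) (ℕ.m≤m+n (α * suc u) (β * v + γ * w))))
  +≡ : + (α * suc u + (β * v + γ * w)) ≡ + α ℤ.* + suc u ℤ.+ (+ β ℤ.* + v ℤ.+ + γ ℤ.* + w)
  +≡ = cong₂ ℤ._+_ (ℤ.pos-* α (suc u)) (cong₂ ℤ._+_ (ℤ.pos-* β v) (ℤ.pos-* γ w))
line-length⁺ {y = + v} { -[1+ w ]} x≤ y≤ z≤ M = line-length⁺⁺⁻ x≤ y≤ z≤ M
line-length⁺ {m} {y = -[1+ v ]} {+ w} {α} {β} {γ} x≤ y≤ z≤ M =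
  subst (λ n → n + 3 ≤ 4 * m) (lemma α β γ) (line-length⁺⁺⁻ x≤ z≤ y≤ (Lin-minimal-swap₂₃ M))
  where
  lemma : ∀ α β γ → α + γ + β ≡ α + β + γ
  lemma = ℕSolver.solve-∀
line-length⁺ {m} {y = -[1+ v ]} { -[1+ w ]} {α} {β} {γ} x≤ y≤ z≤ M =
  subst (λ n → n + 3 ≤ 4 * m) (lemma α β γ)
    (line-length⁺⁺⁻ y≤ z≤ x≤ (Lin-minimal-swap₂₃ (Lin-minimal-swap₁₂ (Lin-minimal-neg M))))
  where
  lemma : ∀ α β γ → β + γ + α ≡ α + β + γ
  lemma = ℕSolver.solve-∀

line-length : ∀ {m x y z α β γ} → ∣ x ∣ ≤ m → ∣ y ∣ ≤ m → ∣ z ∣ ≤ m → Minimal (Lin x y z) α β γ →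
              α + β + γ + 3 ≤ 4 * m
line-length {x = + 0} _ _ _ M = contradiction refl (Lin-minimal⇒x≢0 M)
line-length {x = + suc u} x≤ y≤ z≤ M = line-length⁺ x≤ y≤ z≤ M
line-length {x = -[1+ u ]} {y} {z} x≤ y≤ z≤ M =
  line-length⁺ x≤ (subst (_≤ _) (sym (ℤ.∣-i∣≡∣i∣ y)) y≤) (subst (_≤ _) (sym (ℤ.∣-i∣≡∣i∣ z)) z≤) (Lin-minimal-neg M)

-- x₁ times the relation in y equals y₁ times the relation in x plus multiples of the two vanishing
-- determinants.
Lin-transfer : ∀ {x₁ x₂ x₃ y₁ y₂ y₃ i j k} → x₁ ≢ 0ℤ →
  x₁ ℤ.* y₂ ℤ.- y₁ ℤ.* x₂ ≡ 0ℤ → x₃ ℤ.* y₁ ℤ.- y₃ ℤ.* x₁ ≡ 0ℤ →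
  Lin x₁ x₂ x₃ i j k → Lin y₁ y₂ y₃ i j k
Lin-transfer {x₁} {x₂} {x₃} {y₁} {y₂} {y₃} {i} {j} {k} x₁≢0 e₁₂ e₃₁ (lin e) = lin
  ([ (λ x₁≡0 → contradiction x₁≡0 x₁≢0) , (λ e → e) ]′
    (ℤ.i*j≡0⇒i≡0∨j≡0 x₁ {+ i ℤ.* y₁ ℤ.+ (+ j ℤ.* y₂ ℤ.+ + k ℤ.* y₃)} eq))
  where
  open ≡-Reasoning
  lemma : ∀ i j k x₁ x₂ x₃ y₁ y₂ y₃ → x₁ ℤ.* (i ℤ.* y₁ ℤ.+ (j ℤ.* y₂ ℤ.+ k ℤ.* y₃)) ≡
    y₁ ℤ.* (i ℤ.* x₁ ℤ.+ (j ℤ.* x₂ ℤ.+ k ℤ.* x₃)) ℤ.+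
    (j ℤ.* (x₁ ℤ.* y₂ ℤ.- y₁ ℤ.* x₂) ℤ.- k ℤ.* (x₃ ℤ.* y₁ ℤ.- y₃ ℤ.* x₁))
  lemma = ℤSolver.solve-∀
  lemma₀ : ∀ y j k → y ℤ.* 0ℤ ℤ.+ (j ℤ.* 0ℤ ℤ.- k ℤ.* 0ℤ) ≡ 0ℤ
  lemma₀ = ℤSolver.solve-∀
  eq : x₁ ℤ.* (+ i ℤ.* y₁ ℤ.+ (+ j ℤ.* y₂ ℤ.+ + k ℤ.* y₃)) ≡ 0ℤ
  eq = begin
    x₁ ℤ.* (+ i ℤ.* y₁ ℤ.+ (+ j ℤ.* y₂ ℤ.+ + k ℤ.* y₃))
      ≡⟨ lemma (+ i) (+ j) (+ k) x₁ x₂ x₃ y₁ y₂ y₃ ⟩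
    y₁ ℤ.* (+ i ℤ.* x₁ ℤ.+ (+ j ℤ.* x₂ ℤ.+ + k ℤ.* x₃)) ℤ.+
    (+ j ℤ.* (x₁ ℤ.* y₂ ℤ.- y₁ ℤ.* x₂) ℤ.- + k ℤ.* (x₃ ℤ.* y₁ ℤ.- y₃ ℤ.* x₁))
      ≡⟨ cong₂ (λ u v → y₁ ℤ.* u ℤ.+ v) e (cong₂ (λ u v → + j ℤ.* u ℤ.- + k ℤ.* v) e₁₂ e₃₁) ⟩
    y₁ ℤ.* 0ℤ ℤ.+ (+ j ℤ.* 0ℤ ℤ.- + k ℤ.* 0ℤ)
      ≡⟨ lemma₀ y₁ (+ j) (+ k) ⟩
    0ℤ ∎

abs≤ : ∀ {x m} → ℤ.- + m ℤ.≤ x → x ℤ.≤ + m → ∣ x ∣ ≤ m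
abs≤ {+ n} _ x≤m = ℤ.drop‿+≤+ x≤m
abs≤ { -[1+ n ]} {suc m} (ℤ.-≤- n≤m) _ = s≤s n≤m

-- Projecting to a coordinate in which `a` does not vanish is injective on the line, so it preserves
-- minimality and reduces to integers. One of the coordinates qualifies, because `a` = 0 would be
-- zero-sum on its own.
collinear-length : ∀ {m a b c α β γ} → InBox m a → InBox m b → InBox m c →
  det a b ≡ 0ℤ → det c a ≡ 0ℤ → Minimal (Null a b c) α β γ → α + β + γ + 3 ≤ 4 * m
collinear-length {m} {x₁ , y₁} {x₂ , y₂} {x₃ , y₃} {α} {β} {γ}
  ((l₁ , r₁) , (d₁ , t₁)) ((l₂ , r₂) , (d₂ , t₂)) ((l₃ , r₃) , (d₃ , t₃)) e₁₂ e₃₁ M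
  with x₁ ℤ.≟ 0ℤ
... | no x₁≢0 = line-length (abs≤ l₁ r₁) (abs≤ l₂ r₂) (abs≤ l₃ r₃)
  (Minimal-cong M Null.null₁ (λ e → null e (Lin-transfer x₁≢0 e₁₂ e₃₁ e)))
... | yes refl = line-length (abs≤ d₁ t₁) (abs≤ d₂ t₂) (abs≤ d₃ t₃)
  (Minimal-cong M Null.null₂ (λ e → null (Lin-transfer y₁≢0 (flip 0ℤ y₁ x₂ y₂ e₁₂) (flip x₃ y₃ 0ℤ y₁ e₃₁) e) e))
  where
  flip : ∀ x y x′ y′ → x ℤ.* y′ ℤ.- y ℤ.* x′ ≡ 0ℤ → y ℤ.* x′ ℤ.- x ℤ.* y′ ≡ 0ℤ
  flip x y x′ y′ e = trans (lemma x y x′ y′) (cong ℤ.-_ e)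
    where
    lemma : ∀ x y x′ y′ → y ℤ.* x′ ℤ.- x ℤ.* y′ ≡ ℤ.- (x ℤ.* y′ ℤ.- y ℤ.* x′)
    lemma = ℤSolver.solve-∀
  y₁≢0 : y₁ ≢ 0ℤ
  y₁≢0 refl = ¬holds-ij0 M {1} {0} (Minimal.α>0 M) z≤n (λ ()) (null (lin (lemma x₂ x₃)) (lin (lemma y₂ y₃)))
    where
    lemma : ∀ y z → + 1 ℤ.* 0ℤ ℤ.+ (0ℤ ℤ.* y ℤ.+ 0ℤ ℤ.* z) ≡ 0ℤ
    lemma = ℤSolver.solve-∀

-- Numerical comparison with 4 m² - q(m), and the arithmetic of u v

module _ {m q : ℕ} (2≤m : 2 ≤ m) (q≤1+m : q ≤ suc m) where

  collinear-short : ∀ {l} → l + 3 ≤ 4 * m → l + q < 4 * m * m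
  collinear-short {l} l+3≤4m with ℕ.m≤n⇒∃[o]m+o≡n 2≤m
  ... | k , refl = ℕ.+-cancelʳ-≤ 3 (suc (l + q)) (4 * (2 + k) * (2 + k)) (begin
    suc (l + q) + 3                            ≡⟨ lemma₁ l q ⟩
    (l + 3) + suc q                            ≤⟨ ℕ.+-mono-≤ l+3≤4m (s≤s q≤1+m) ⟩
    -- With m = k + 2 the difference of the two sides is a polynomial in k with nonnegative
    -- coefficients; the next two comparisons work in the same way.
    4 * (2 + k) + suc (suc (2 + k))            ≤⟨ ℕ.m≤m+n _ (4 * (k * k) + 11 * k + 7) ⟩
    4 * (2 + k) + suc (suc (2 + k)) + (4 * (k * k) + 11 * k + 7)  ≡⟨ lemma₂ k ⟩
    4 * (2 + k) * (2 + k) + 3                  ∎)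
    where
    open ℕ.≤-Reasoning
    lemma₁ : ∀ l q → suc (l + q) + 3 ≡ (l + 3) + suc q
    lemma₁ = ℕSolver.solve-∀
    lemma₂ : ∀ k → 4 * (2 + k) + suc (suc (2 + k)) + (4 * (k * k) + 11 * k + 7) ≡ 4 * (2 + k) * (2 + k) + 3
    lemma₂ = ℕSolver.solve-∀

  -- 2 m (2 m - 1) + (m + 1) = 4 m² - (m - 1).
  narrow-short : ∀ {l n} → suc n ≡ m → l ≤ (m + n) * (m + m) → l + q < 4 * m * m
  narrow-short {l} {n} 1+n≡m l≤ with ℕ.m≤n⇒∃[o]m+o≡n 2≤m
  narrow-short {l} {n} refl l≤ | k , refl = begin-strict
    l + q                                                          ≤⟨ ℕ.+-mono-≤ l≤ q≤1+m ⟩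
    (2 + k + (1 + k)) * (2 + k + (2 + k)) + suc (2 + k)            <⟨ ℕ.m<m+n _ z<s ⟩
    (2 + k + (1 + k)) * (2 + k + (2 + k)) + suc (2 + k) + suc k    ≡⟨ lemma k ⟩
    4 * (2 + k) * (2 + k)                                          ∎
    where
    open ℕ.≤-Reasoning
    lemma : ∀ k → (2 + k + (1 + k)) * (2 + k + (2 + k)) + suc (2 + k) + suc k ≡ 4 * (2 + k) * (2 + k)
    lemma = ℕSolver.solve-∀

  half-short : ∀ {l} → 2 * l ≤ 4 * m * m → l + q < 4 * m * m
  half-short {l} 2l≤ with ℕ.m≤n⇒∃[o]m+o≡n 2≤m
  ... | k , refl = begin-strict
    l + q                            ≤⟨ ℕ.+-mono-≤ l≤ q≤1+m ⟩
    2 * (2 + k) * (2 + k) + suc (2 + k)   <⟨ ℕ.m<m+n _ z<s ⟩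
    2 * (2 + k) * (2 + k) + suc (2 + k) + suc (4 + 7 * k + 2 * (k * k))   ≡⟨ lemma k ⟩
    4 * (2 + k) * (2 + k)            ∎
    where
    open ℕ.≤-Reasoning
    lemma : ∀ k → 2 * (2 + k) * (2 + k) + suc (2 + k) + suc (4 + 7 * k + 2 * (k * k)) ≡ 4 * (2 + k) * (2 + k)
    lemma = ℕSolver.solve-∀
    double : ∀ k → 4 * (2 + k) * (2 + k) ≡ 2 * (2 * (2 + k) * (2 + k))
    double = ℕSolver.solve-∀
    l≤ : l ≤ 2 * (2 + k) * (2 + k)
    l≤ = ℕ.*-cancelˡ-≤ 2 (ℕ.≤-trans 2l≤ (ℕ.≤-reflexive (double k)))

-- α, β and γ are the determinants of the triangle (m , m), (- m , m - v), (m - u , - m).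
module _ {m q u u′ v v′ α β γ : ℕ} (2≤m : 2 ≤ m) (isQ : IsQ m q)
         (u+u′ : u + u′ ≡ m + m) (v+v′ : v + v′ ≡ m + m)
         (eα : α + u * v ≡ m * (u + v)) (eβ : β ≡ m * u′) (eγ : γ ≡ m * v′)
         (coprime : Coprime₃ α β γ) where

  private
    ∣β : ∀ {d} → d ∣ m → d ∣ β
    ∣β d∣m = subst (_ ∣_) (sym eβ) (∣m⇒∣m*n u′ d∣m)
    ∣γ : ∀ {d} → d ∣ m → d ∣ γ
    ∣γ d∣m = subst (_ ∣_) (sym eγ) (∣m⇒∣m*n v′ d∣m)
    ∣α : ∀ {d} → d ∣ u * v → d ∣ m → d ∣ α
    ∣α {d} d∣uv d∣m = ∣m+n∣m⇒∣n (subst (d ∣_) (trans (sym eα) (ℕ.+-comm α (u * v))) (∣m⇒∣m*n (u + v) d∣m)) d∣uv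

  -- Otherwise α = m (u + v), and `m` divides all three multiplicities.
  u*v≢0 : u * v ≢ 0
  u*v≢0 uv≡0 = coprime 2≤m (∣α (subst (m ∣_) (sym uv≡0) (m ∣0)) ∣-refl) (∣β ∣-refl) (∣γ ∣-refl)

  -- Here the common divisor is not `m`: with u = v = 1, α = u′ = v′ = 2 m - 1, and this number
  -- divides β and γ as well.
  u*v≢1 : u * v ≢ 1
  u*v≢1 uv≡1 with ℕ.m*n≡1⇒m≡1 u v uv≡1 | ℕ.m*n≡1⇒n≡1 u v uv≡1
  ... | refl | refl = coprime 2≤u′ (∣-reflexive (sym α≡u′)) (u′∣ eβ) (u′∣ (trans eγ (cong (m *_) v′≡u′)))
    where
    v′≡u′ : v′ ≡ u′
    v′≡u′ = ℕ.suc-injective (trans v+v′ (sym u+u′))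
    α≡u′ : α ≡ u′
    α≡u′ = ℕ.suc-injective (trans (ℕ.+-comm 1 α) (trans eα (trans (lemma m) (sym u+u′))))
      where
      lemma : ∀ m → m * 2 ≡ m + m
      lemma = ℕSolver.solve-∀
    u′∣ : ∀ {δ} → δ ≡ m * u′ → u′ ∣ δ
    u′∣ e = subst (u′ ∣_) (sym e) (n∣m*n m)
    2≤u′ : 2 ≤ u′
    2≤u′ = ℕ.≤-pred (ℕ.≤-trans (ℕ.m≤m+n 3 1) (ℕ.≤-trans (ℕ.+-mono-≤ 2≤m 2≤m) (ℕ.≤-reflexive (sym u+u′))))

  -- A prime dividing both u v and m divides α = m (u + v) - u v and the multiples β, γ of m. So a
  -- prime divisor of u v does not divide m, hence is at least q and at most u v.
  q≤u*v : q ≤ u * v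
  q≤u*v with ∃-primeDivisor (2≤ (u * v) u*v≢0 u*v≢1)
    where
    2≤ : ∀ n → n ≢ 0 → n ≢ 1 → 2 ≤ n
    2≤ 0 ≢0 _ = contradiction refl ≢0
    2≤ 1 _ ≢1 = contradiction refl ≢1
    2≤ (suc (suc n)) _ _ = s≤s (s≤s z≤n)
  ... | p , pr , p∣uv = ℕ.≤-trans (proj₂ (proj₂ isQ) p pr p∤m) (∣⇒≤ {{≢-nonZero u*v≢0}} p∣uv)
    where
    p∤m : ¬ p ∣ m
    p∤m p∣m = coprime (prime⇒≥2 pr) (∣α p∣uv p∣m) (∣β p∣m) (∣γ p∣m)

-- Here `n` is the scale. The terms linear in u and v cancel in the sum of the determinants, since u
-- + u′ and v + v′ are constant.
corner-sum : ∀ {m n u u′ v v′ α β γ} → u + u′ ≡ m + m → v + v′ ≡ m + m →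
  n * α + u * v ≡ m * (u + v) → n * β ≡ m * u′ → n * γ ≡ m * v′ →
  n * (α + β + γ) + u * v ≡ 4 * m * m
corner-sum {m} {n} {u} {u′} {v} {v′} {α} {β} {γ} u+u′ v+v′ eα eβ eγ = begin
  n * (α + β + γ) + u * v                  ≡⟨ lemma₁ n α β γ (u * v) ⟩
  (n * α + u * v) + (n * β + n * γ)        ≡⟨ cong₂ _+_ eα (cong₂ _+_ eβ eγ) ⟩
  m * (u + v) + (m * u′ + m * v′)          ≡⟨ lemma₂ m u v u′ v′ ⟩
  m * ((u + u′) + (v + v′))                ≡⟨ cong₂ (λ x y → m * (x + y)) u+u′ v+v′ ⟩
  m * ((m + m) + (m + m))                  ≡⟨ lemma₃ m ⟩
  4 * m * m                                ∎
  where
  open ≡-Reasoning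
  lemma₁ : ∀ n α β γ w → n * (α + β + γ) + w ≡ (n * α + w) + (n * β + n * γ)
  lemma₁ = ℕSolver.solve-∀
  lemma₂ : ∀ m u v u′ v′ → m * (u + v) + (m * u′ + m * v′) ≡ m * ((u + u′) + (v + v′))
  lemma₂ = ℕSolver.solve-∀
  lemma₃ : ∀ m → m * ((m + m) + (m + m)) ≡ 4 * m * m
  lemma₃ = ℕSolver.solve-∀

-- The case u = q, v = 1. A common prime p dividing m would divide q, so p = q, which does not
-- divide m. Otherwise p divides u′ and v′, hence v′ - u′ = q - 1, although p ≥ q by the minimality
-- of q.
extremal-coprime : ∀ {m q u′ v′ α} → IsQ m q → q + u′ ≡ m + m → 1 + v′ ≡ m + m →
  α + q ≡ m * (q + 1) → Coprime₃ α (m * u′) (m * v′)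
extremal-coprime {m} {q} {u′} {v′} {α} (prq , q∤m , least) eu ev eα 2≤d d∣α d∣β d∣γ
  with ∃-primeDivisor 2≤d
... | p , pr , p∣d = [ p∣m⇒⊥ , (λ p∣u′ → [ p∣m⇒⊥ , p∣u′⇒p∣v′⇒⊥ p∣u′ ]′ (euclidsLemma m v′ pr (∣-trans p∣d d∣γ))) ]′
                      (euclidsLemma m u′ pr (∣-trans p∣d d∣β))
  where
  p∣m⇒⊥ : ¬ p ∣ m
  p∣m⇒⊥ p∣m with prime⇒irreducible prq (∣m+n∣m⇒∣n (subst (p ∣_) (sym eα) (∣m⇒∣m*n (q + 1) p∣m)) (∣-trans p∣d d∣α))
  ... | inj₁ p≡1 = ℕ.<⇒≢ (prime⇒≥2 pr) (sym p≡1)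
  ... | inj₂ refl = q∤m p∣m
  p∣u′⇒p∣v′⇒⊥ : p ∣ u′ → ¬ p ∣ v′
  p∣u′⇒p∣v′⇒⊥ p∣u′ p∣v′ with ℕ.m≤n⇒∃[o]m+o≡n (prime⇒≥2 prq)
  ... | r , refl = ℕ.<-irrefl refl (ℕ.≤-trans (least p pr p∣m⇒⊥) (∣⇒≤ p∣1+r))
    where
    p∣1+r : p ∣ suc r
    p∣1+r = ∣m+n∣m⇒∣n (subst (p ∣_) (trans (ℕ.suc-injective (trans ev (sym eu))) (ℕ.+-comm (suc r) u′)) p∣v′) p∣u′

-- The relation is the identity det(b,c) a + det(c,a) b + det(a,b) c = 0. For any other relation
-- Cramer's rule gives i γ = k α and j γ = k β; coprimality then yields γ ∣ k, and k ≤ γ leaves only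
-- k = 0 and k = γ.
scaled⇒minimal : ∀ {a b c α β γ} → 0 < α → 0 < β → 0 < γ → Coprime₃ α β γ →
  det b c ≡ + α → det c a ≡ + β → det a b ≡ + γ → Minimal (Null a b c) α β γ
scaled⇒minimal {a@(x₁ , y₁)} {b@(x₂ , y₂)} {c@(x₃ , y₃)} {α} {β} {γ} α>0 β>0 γ>0 coprime ebc eca eab = record
  { α>0 = α>0 ; β>0 = β>0 ; γ>0 = γ>0
  ; holds = null (lin (combine (lemma₁ x₁ x₂ x₃ y₁ y₂ y₃))) (lin (combine (lemma₂ x₁ x₂ x₃ y₁ y₂ y₃)))
  ; minimal = min }
  where
  lemma₁ : ∀ x₁ x₂ x₃ y₁ y₂ y₃ → (x₂ ℤ.* y₃ ℤ.- y₂ ℤ.* x₃) ℤ.* x₁ ℤ.+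
    ((x₃ ℤ.* y₁ ℤ.- y₃ ℤ.* x₁) ℤ.* x₂ ℤ.+ (x₁ ℤ.* y₂ ℤ.- y₁ ℤ.* x₂) ℤ.* x₃) ≡ 0ℤ
  lemma₁ = ℤSolver.solve-∀
  lemma₂ : ∀ x₁ x₂ x₃ y₁ y₂ y₃ → (x₂ ℤ.* y₃ ℤ.- y₂ ℤ.* x₃) ℤ.* y₁ ℤ.+
    ((x₃ ℤ.* y₁ ℤ.- y₃ ℤ.* x₁) ℤ.* y₂ ℤ.+ (x₁ ℤ.* y₂ ℤ.- y₁ ℤ.* x₂) ℤ.* y₃) ≡ 0ℤ
  lemma₂ = ℤSolver.solve-∀
  combine : ∀ {x y z} → det b c ℤ.* x ℤ.+ (det c a ℤ.* y ℤ.+ det a b ℤ.* z) ≡ 0ℤ →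
            + α ℤ.* x ℤ.+ (+ β ℤ.* y ℤ.+ + γ ℤ.* z) ≡ 0ℤ
  combine {x} {y} {z} e = trans (sym (cong₂ ℤ._+_ (cong (ℤ._* x) ebc) (cong₂ ℤ._+_ (cong (ℤ._* y) eca) (cong (ℤ._* z) eab)))) e
  proportional : ∀ {i k D E δ ε} → D ≡ + δ → E ≡ + ε → + i ℤ.* D ≡ + k ℤ.* E → i * δ ≡ k * ε
  proportional {i} {k} {δ = δ} {ε} refl refl e = ℤ.+-injective (trans (ℤ.pos-* i δ) (trans e (sym (ℤ.pos-* k ε))))
  min : ∀ {i j k} → i ≤ α → j ≤ β → k ≤ γ → Null a b c i j k →
        (i ≡ 0 × j ≡ 0 × k ≡ 0) ⊎ (i ≡ α × j ≡ β × k ≡ γ)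
  min {i} {j} {k} i≤α j≤β k≤γ r = multiple (coprime-divisor₃ {α} {β} {γ} {k} γ>0 coprime
      (subst (γ ∣_) iγ≡kα (n∣m*n i)) (subst (γ ∣_) (sym kβ≡jγ) (n∣m*n j)) (n∣m*n k))
    where
    instance _ = >-nonZero γ>0
    iγ≡kα : i * γ ≡ k * α
    iγ≡kα = proportional {i} {k} eab ebc (cramer r)
    kβ≡jγ : k * β ≡ j * γ
    kβ≡jγ = proportional {k} {j} eca eab (cramer (Null-rotate (Null-rotate r)))
    multiple : γ ∣ k → (i ≡ 0 × j ≡ 0 × k ≡ 0) ⊎ (i ≡ α × j ≡ β × k ≡ γ)
    multiple (divides 0 refl) = inj₁ (zero-product iγ≡kα , zero-product (sym kβ≡jγ) , refl)
      where
      zero-product : ∀ {n} → n * γ ≡ 0 → n ≡ 0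
      zero-product {n} e = ℕ.m*n≡0⇒m≡0 n γ e
    multiple (divides 1 refl) = inj₂ (ℕ.*-cancelʳ-≡ i α γ (trans iγ≡kα (lemma γ α)) ,
                                      ℕ.*-cancelʳ-≡ j β γ (trans (sym kβ≡jγ) (lemma γ β)) , ℕ.+-identityʳ γ)
      where
      lemma : ∀ γ α → (γ + 0) * α ≡ α * γ
      lemma = ℕSolver.solve-∀
    multiple (divides (suc (suc t)) refl) = contradiction k≤γ (ℕ.<⇒≱ (ℕ.m<m+n γ (ℕ.<-≤-trans γ>0 (ℕ.m≤m+n γ (t * γ)))))

-- Sequences with three values as blocks of repeated points

module _ {A : Set} where

  replicate-++-⊆ : ∀ {a : A} {xs ys i j} → i ≤ j → xs ⊆ ys → replicate i a ++ xs ⊆ replicate j a ++ ys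
  replicate-++-⊆ {j = zero}  z≤n xs⊆ys = xs⊆ys
  replicate-++-⊆ {a} {j = suc j} z≤n xs⊆ys = a ∷ʳ replicate-++-⊆ {j = j} z≤n xs⊆ys
  replicate-++-⊆ (s≤s i≤j) xs⊆ys = refl ∷ replicate-++-⊆ i≤j xs⊆ys

  ⊆-replicate-++ : ∀ {a : A} {zs ys} j → zs ⊆ replicate j a ++ ys →
                   ∃₂ λ i xs → i ≤ j × xs ⊆ ys × zs ≡ replicate i a ++ xs
  ⊆-replicate-++ zero p = 0 , _ , z≤n , p , refl
  ⊆-replicate-++ (suc j) (_ ∷ʳ p) with ⊆-replicate-++ j p
  ... | i , xs , i≤j , xs⊆ys , refl = i , xs , ℕ.m≤n⇒m≤1+n i≤j , xs⊆ys , refl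
  ⊆-replicate-++ (suc j) (refl ∷ p) with ⊆-replicate-++ j p
  ... | i , xs , i≤j , xs⊆ys , refl = suc i , xs , s≤s i≤j , xs⊆ys , refl

  -- Minimality of a sequence quantifies over sublists in its own order, while parts are chosen in
  -- the block order.
  ↭-⊆ : ∀ {xs ys zs : List A} → xs ↭ ys → zs ⊆ ys → ∃ λ ws → ws ⊆ xs × ws ↭ zs
  ↭-⊆ Perm.refl p = _ , p , ↭-refl
  ↭-⊆ (Perm.prep x r) (_ ∷ʳ p) with ↭-⊆ r p
  ... | ws , q , s = ws , x ∷ʳ q , s
  ↭-⊆ (Perm.prep x r) (refl ∷ p) with ↭-⊆ r p
  ... | ws , q , s = x ∷ ws , refl ∷ q , Perm.prep x s
  ↭-⊆ (Perm.swap x y r) (_ ∷ʳ (_ ∷ʳ p)) with ↭-⊆ r p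
  ... | ws , q , s = ws , x ∷ʳ (y ∷ʳ q) , s
  ↭-⊆ (Perm.swap x y r) (_ ∷ʳ (refl ∷ p)) with ↭-⊆ r p
  ... | ws , q , s = x ∷ ws , refl ∷ (y ∷ʳ q) , Perm.prep x s
  ↭-⊆ (Perm.swap x y r) (refl ∷ (_ ∷ʳ p)) with ↭-⊆ r p
  ... | ws , q , s = y ∷ ws , x ∷ʳ (refl ∷ q) , Perm.prep y s
  ↭-⊆ (Perm.swap x y r) (refl ∷ (refl ∷ p)) with ↭-⊆ r p
  ... | ws , q , s = x ∷ y ∷ ws , refl ∷ (refl ∷ q) , Perm.swap x y s
  ↭-⊆ (Perm.trans r₁ r₂) p with ↭-⊆ r₂ p
  ... | ws , q , s with ↭-⊆ r₁ q
  ... | vs , q′ , s′ = vs , q′ , ↭-trans s′ s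

  blocks : A → A → A → ℕ → ℕ → ℕ → List A
  blocks a b c i j k = replicate i a ++ replicate j b ++ replicate k c

  length-blocks : ∀ {a b c : A} i j k → length (blocks a b c i j k) ≡ i + j + k
  length-blocks {a} {b} {c} i j k = begin
    length (blocks a b c i j k)                                  ≡⟨ length-++ (replicate i a) ⟩
    length (replicate i a) + length (replicate j b ++ replicate k c)  ≡⟨ cong₂ _+_ (length-replicate i) (length-++ (replicate j b)) ⟩
    i + (length (replicate j b) + length (replicate k c))        ≡⟨ cong (_+_ i) (cong₂ _+_ (length-replicate j) (length-replicate k)) ⟩
    i + (j + k)                                                  ≡⟨ ℕ.+-assoc i j k ⟨
    i + j + k                                                    ∎
    where open ≡-Reasoning

  blocks-⊆ : ∀ {a b c : A} {i j k i′ j′ k′} → i ≤ i′ → j ≤ j′ → k ≤ k′ → blocks a b c i j k ⊆ blocks a b c i′ j′ k′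
  blocks-⊆ {c = c} {k = k} {k′ = k′} i≤ j≤ k≤ = replicate-++-⊆ i≤ (replicate-++-⊆ j≤
    (subst₂ _⊆_ (++-identityʳ (replicate k c)) (++-identityʳ (replicate k′ c)) (replicate-++-⊆ k≤ [])))

  ⊆-blocks : ∀ {a b c : A} {xs} i j k → xs ⊆ blocks a b c i j k →
             ∃ λ i′ → ∃₂ λ j′ k′ → i′ ≤ i × j′ ≤ j × k′ ≤ k × xs ≡ blocks a b c i′ j′ k′
  ⊆-blocks {a} {b} {c} i j k p with ⊆-replicate-++ i p
  ... | i′ , _ , i′≤i , q , refl with ⊆-replicate-++ j q
  ... | j′ , _ , j′≤j , r , refl with ⊆-replicate-++ k (subst (_ ⊆_) (sym (++-identityʳ (replicate k c))) r)
  ... | k′ , _ , k′≤k , [] , refl = i′ , j′ , k′ , i′≤i , j′≤j , k′≤k ,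
    cong (λ xs → replicate i′ a ++ replicate j′ b ++ xs) (++-identityʳ (replicate k′ c))

  ∈-replicate : ∀ {x a : A} n → x ∈ replicate n a → x ≡ a
  ∈-replicate (suc n) (here e) = e
  ∈-replicate (suc n) (there p) = ∈-replicate n p

  blocks-swap₁₂ : ∀ {a b c : A} i j k → blocks b a c j i k ↭ blocks a b c i j k
  blocks-swap₁₂ {a} {b} i j k = shifts (replicate j b) (replicate i a)

  blocks-swap₂₃ : ∀ {a b c : A} i j k → blocks a c b i k j ↭ blocks a b c i j k
  blocks-swap₂₃ {a} {b} {c} i j k = ++⁺ˡ (replicate i a) (++-comm (replicate k c) (replicate j b))

  blocks-collect : ∀ {a b c : A} {xs} → All (_∈ (a ∷ b ∷ c ∷ [])) xs →
                   ∃ λ i → ∃₂ λ j k → xs ↭ blocks a b c i j k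
  blocks-collect [] = 0 , 0 , 0 , ↭-refl
  blocks-collect {a} {b} {c} (p ∷ ps) with blocks-collect ps
  blocks-collect {a} {b} {c} (here refl ∷ _) | i , j , k , r = suc i , j , k , Perm.prep a r
  blocks-collect {a} {b} {c} (there (here refl) ∷ _) | i , j , k , r = i , suc j , k ,
    ↭-trans (Perm.prep b r) (↭-sym (shift b (replicate i a) (replicate j b ++ replicate k c)))
  blocks-collect {a} {b} {c} (there (there (here refl)) ∷ _) | i , j , k , r = i , j , suc k ,
    ↭-trans (Perm.prep c r) (↭-trans (↭-sym (shift c (replicate i a) (replicate j b ++ replicate k c)))
      (++⁺ˡ (replicate i a) (↭-sym (shift c (replicate j b) (replicate k c)))))

  ∈-blocks⁻ : ∀ {x a b c : A} i j k → x ∈ blocks a b c i j k → x ≢ a → x ≢ b → 0 < k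
  ∈-blocks⁻ {a = a} {b} {c} i j k p x≢a x≢b with ∈-++⁻ (replicate i a) p
  ... | inj₁ q = contradiction (∈-replicate i q) x≢a
  ... | inj₂ q with ∈-++⁻ (replicate j b) q
  ... | inj₁ r = contradiction (∈-replicate j r) x≢b
  ... | inj₂ r = nonempty k r
    where
    nonempty : ∀ {x c : A} k → x ∈ replicate k c → 0 < k
    nonempty (suc k) _ = z<s

+Pt-assoc : ∀ p q r → (p +Pt q) +Pt r ≡ p +Pt (q +Pt r)
+Pt-assoc (x₁ , y₁) (x₂ , y₂) (x₃ , y₃) = cong₂ _,_ (ℤ.+-assoc x₁ x₂ x₃) (ℤ.+-assoc y₁ y₂ y₃)

+Pt-comm : ∀ p q → p +Pt q ≡ q +Pt p
+Pt-comm (x₁ , y₁) (x₂ , y₂) = cong₂ _,_ (ℤ.+-comm x₁ x₂) (ℤ.+-comm y₁ y₂)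

+Pt-identityˡ : ∀ p → 0Pt +Pt p ≡ p
+Pt-identityˡ (x , y) = cong₂ _,_ (ℤ.+-identityˡ x) (ℤ.+-identityˡ y)

σ-++ : ∀ xs ys → σ (xs ++ ys) ≡ σ xs +Pt σ ys
σ-++ [] ys = sym (+Pt-identityˡ (σ ys))
σ-++ (x ∷ xs) ys = trans (cong (x +Pt_) (σ-++ xs ys)) (sym (+Pt-assoc x (σ xs) (σ ys)))

σ-↭ : ∀ {xs ys} → xs ↭ ys → σ xs ≡ σ ys
σ-↭ Perm.refl = refl
σ-↭ (Perm.prep x r) = cong (x +Pt_) (σ-↭ r)
σ-↭ {_} {_ ∷ _ ∷ ys} (Perm.swap x y r) rewrite σ-↭ r =
  trans (sym (+Pt-assoc x y (σ ys))) (trans (cong (_+Pt σ ys) (+Pt-comm x y)) (+Pt-assoc y x (σ ys)))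
σ-↭ (Perm.trans r s) = trans (σ-↭ r) (σ-↭ s)

σ-replicate : ∀ n p → σ (replicate n p) ≡ (+ n ℤ.* proj₁ p , + n ℤ.* proj₂ p)
σ-replicate zero p = refl
σ-replicate (suc n) p = trans (cong (p +Pt_) (σ-replicate n p))
  (cong₂ _,_ (sym (ℤ.suc-* (+ n) (proj₁ p))) (sym (ℤ.suc-* (+ n) (proj₂ p))))

σ-blocks : ∀ {a b c} i j k → σ (blocks a b c i j k) ≡
  ( + i ℤ.* proj₁ a ℤ.+ (+ j ℤ.* proj₁ b ℤ.+ + k ℤ.* proj₁ c)
  , + i ℤ.* proj₂ a ℤ.+ (+ j ℤ.* proj₂ b ℤ.+ + k ℤ.* proj₂ c))
σ-blocks {a} {b} {c} i j k = trans (σ-++ (replicate i a) _) (cong₂ _+Pt_ (σ-replicate i a)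
  (trans (σ-++ (replicate j b) _) (cong₂ _+Pt_ (σ-replicate j b) (σ-replicate k c))))

σ≡0⇒Null : ∀ {a b c i j k} → σ (blocks a b c i j k) ≡ 0Pt → Null a b c i j k
σ≡0⇒Null {i = i} {j} {k} e with trans (sym (σ-blocks i j k)) e
... | e′ = null (lin (cong proj₁ e′)) (lin (cong proj₂ e′))

Null⇒σ≡0 : ∀ {a b c i j k} → Null a b c i j k → σ (blocks a b c i j k) ≡ 0Pt
Null⇒σ≡0 {i = i} {j} {k} (null (lin e₁) (lin e₂)) = trans (σ-blocks i j k) (cong₂ _,_ e₁ e₂)

sum-equal : ∀ {i j k i′ j′ k′} → i ≤ i′ → j ≤ j′ → k ≤ k′ → i′ + j′ + k′ ≤ i + j + k →
            i ≡ i′ × j ≡ j′ × k ≡ k′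
sum-equal {i} {j} {k} {i′} {j′} {k′} i≤ j≤ k≤ s with i ℕ.≟ i′ | j ℕ.≟ j′ | k ℕ.≟ k′
... | yes p | yes q | yes r = p , q , r
... | no p | _ | _ = contradiction s (ℕ.<⇒≱ (ℕ.+-mono-<-≤ (ℕ.+-mono-<-≤ (ℕ.≤∧≢⇒< i≤ p) j≤) k≤))
... | yes _ | no p | _ = contradiction s (ℕ.<⇒≱ (ℕ.+-mono-<-≤ (ℕ.+-mono-≤-< i≤ (ℕ.≤∧≢⇒< j≤ p)) k≤))
... | yes _ | yes _ | no p = contradiction s (ℕ.<⇒≱ (ℕ.+-mono-≤-< (ℕ.+-mono-≤ i≤ j≤) (ℕ.≤∧≢⇒< k≤ p)))

Minimal⇒MinimalZeroSum : ∀ {a b c α β γ} → Minimal (Null a b c) α β γ → MinimalZeroSum (blocks a b c α β γ)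
Minimal⇒MinimalZeroSum {a} {b} {c} {α} {β} {γ} M = Null⇒σ≡0 holds , nonempty , proper
  where
  open Minimal M
  nonempty : blocks a b c α β γ ≢ []
  nonempty e = ℕ.<⇒≢ (ℕ.<-≤-trans α>0 (ℕ.≤-trans (ℕ.m≤m+n α β) (ℕ.m≤m+n (α + β) γ)))
    (sym (trans (sym (length-blocks α β γ)) (cong length e)))
  proper : ∀ T → T ⊆ blocks a b c α β γ → T ≢ [] → length T < length (blocks a b c α β γ) → σ T ≢ 0Pt
  proper T T⊆ T≢[] len< σT≡0 with ⊆-blocks α β γ T⊆
  ... | i , j , k , i≤ , j≤ , k≤ , refl with minimal i≤ j≤ k≤ (σ≡0⇒Null σT≡0)
  ... | inj₁ (refl , refl , refl) = T≢[] refl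
  ... | inj₂ (refl , refl , refl) = ℕ.<-irrefl refl len<

MinimalZeroSum⇒Minimal : ∀ {S a b c α β γ} → MinimalZeroSum S → S ↭ blocks a b c α β γ →
  0 < α → 0 < β → 0 < γ → Minimal (Null a b c) α β γ
MinimalZeroSum⇒Minimal {S} {a} {b} {c} {α} {β} {γ} (σS≡0 , _ , proper) S↭ α>0 β>0 γ>0 = record
  { α>0 = α>0 ; β>0 = β>0 ; γ>0 = γ>0
  ; holds = σ≡0⇒Null (trans (sym (σ-↭ S↭)) σS≡0)
  ; minimal = min }
  where
  length-S : length S ≡ α + β + γ
  length-S = trans (↭-length S↭) (length-blocks α β γ)
  min : ∀ {i j k} → i ≤ α → j ≤ β → k ≤ γ → Null a b c i j k →
        (i ≡ 0 × j ≡ 0 × k ≡ 0) ⊎ (i ≡ α × j ≡ β × k ≡ γ)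
  -- `MinimalZeroSum` excludes the whole sequence by its length, so the full part is recognised by
  -- its total.
  min {i} {j} {k} i≤ j≤ k≤ r with α + β + γ ℕ.≤? i + j + k
  ... | yes full = inj₂ (sum-equal i≤ j≤ k≤ full)
  ... | no ¬full with ↭-⊆ S↭ (blocks-⊆ i≤ j≤ k≤)
  ... | [] , _ , []↭ = inj₁ (ℕ.m+n≡0⇒m≡0 i i+j≡0 , ℕ.m+n≡0⇒n≡0 i i+j≡0 , ℕ.m+n≡0⇒n≡0 (i + j) sum≡0)
    where
    sum≡0 : i + j + k ≡ 0
    sum≡0 = trans (sym (length-blocks i j k)) (sym (↭-length []↭))
    i+j≡0 : i + j ≡ 0
    i+j≡0 = ℕ.m+n≡0⇒m≡0 (i + j) sum≡0
  ... | T@(_ ∷ _) , T⊆S , T↭ = contradiction (trans (σ-↭ T↭) (Null⇒σ≡0 r))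
    (proper T T⊆S (λ ()) (subst₂ _<_ (sym (trans (↭-length T↭) (length-blocks i j k))) (sym length-S) (ℕ.≰⇒> ¬full)))

module _ {A : Set} (_≟_ : (x y : A) → Dec (x ≡ y)) where

  deduplicate-replicate-++ : ∀ n x ys →
    deduplicate _≟_ (replicate (suc n) x ++ ys) ≡ x ∷ filter (¬? ∘ (x ≟_)) (deduplicate _≟_ ys)
  deduplicate-replicate-++ zero x ys = refl
  deduplicate-replicate-++ (suc n) x ys = cong (x ∷_) (begin
    filter x≢? (deduplicate _≟_ (replicate (suc n) x ++ ys))  ≡⟨ cong (filter x≢?) (deduplicate-replicate-++ n x ys) ⟩
    filter x≢? (x ∷ filter x≢? (deduplicate _≟_ ys))          ≡⟨ filter-reject x≢? (λ x≢x → x≢x refl) ⟩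
    filter x≢? (filter x≢? (deduplicate _≟_ ys))              ≡⟨ filter-idem x≢? (deduplicate _≟_ ys) ⟩
    filter x≢? (deduplicate _≟_ ys)                           ∎)
    where
    open ≡-Reasoning
    x≢? = ¬? ∘ (x ≟_)

  deduplicate-blocks : ∀ {a b c i j k} → a ≢ b → a ≢ c → b ≢ c → 0 < i → 0 < j → 0 < k →
    deduplicate _≟_ (blocks a b c i j k) ≡ a ∷ b ∷ c ∷ []
  deduplicate-blocks {a} {b} {c} {suc i} {suc j} {suc k} a≢b a≢c b≢c _ _ _ = begin
    deduplicate _≟_ (blocks a b c (suc i) (suc j) (suc k))
      ≡⟨ deduplicate-replicate-++ i a _ ⟩
    a ∷ filter (¬? ∘ (a ≟_)) (deduplicate _≟_ (replicate (suc j) b ++ replicate (suc k) c))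
      ≡⟨ cong (λ xs → a ∷ filter (¬? ∘ (a ≟_)) xs) (trans (deduplicate-replicate-++ j b _)
           (cong (λ xs → b ∷ filter (¬? ∘ (b ≟_)) xs) dedup-c)) ⟩
    a ∷ filter (¬? ∘ (a ≟_)) (b ∷ filter (¬? ∘ (b ≟_)) (c ∷ []))
      ≡⟨ cong (λ xs → a ∷ filter (¬? ∘ (a ≟_)) (b ∷ xs)) (filter-all (¬? ∘ (b ≟_)) (b≢c ∷ [])) ⟩
    a ∷ filter (¬? ∘ (a ≟_)) (b ∷ c ∷ [])
      ≡⟨ cong (a ∷_) (filter-all (¬? ∘ (a ≟_)) (a≢b ∷ a≢c ∷ [])) ⟩
    a ∷ b ∷ c ∷ [] ∎
    where
    open ≡-Reasoning
    dedup-c : deduplicate _≟_ (replicate (suc k) c) ≡ c ∷ []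
    dedup-c = trans (cong (deduplicate _≟_) (sym (++-identityʳ (replicate (suc k) c)))) (deduplicate-replicate-++ k c [])

support₃ : ∀ S → supportSize S ≡ 3 → ∃ λ a → ∃₂ λ b c →
  deduplicate _≟Pt_ S ≡ a ∷ b ∷ c ∷ []
support₃ S e with deduplicate _≟Pt_ S
support₃ S refl | a ∷ b ∷ c ∷ [] = a , b , c , refl

record Triple (m : ℕ) (a b c : Pt) (α β γ : ℕ) : Set where
  field
    box-a : InBox m a
    box-b : InBox m b
    box-c : InBox m c
    minimal-null : Minimal (Null a b c) α β γ

-- Each multiplicity is positive because its point occurs in `S` and differs from the other two; the
-- block in question is moved to the end to apply `∈-blocks⁻`.
admissible⇒triple : ∀ {m S} → Admissible m S →
  ∃ λ a → ∃₂ λ b c → ∃ λ α → ∃₂ λ β γ → Triple m a b c α β γ × S ↭ blocks a b c α β γ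
admissible⇒triple {m} {S} (boxes , mzs , size) with support₃ S size | deduplicate-! S
... | a , b , c , eq | unique with subst Unique eq unique
... | (a≢b ∷ a≢c ∷ []) ∷ (b≢c ∷ []) ∷ _ with blocks-collect {a = a} {b} {c} (All.tabulate (λ {x} x∈S → subst (x ∈_) eq (∈-deduplicate⁺ _≟Pt_ x∈S)))
... | α , β , γ , S↭ = a , b , c , α , β , γ , record
  { box-a = All.lookup boxes a∈S ; box-b = All.lookup boxes b∈S ; box-c = All.lookup boxes c∈S
  ; minimal-null = MinimalZeroSum⇒Minimal mzs S↭
      (∈-blocks⁻ β γ α (∈-resp-↭ (↭-trans S↭ (↭-trans (↭-sym (blocks-swap₁₂ α β γ)) (↭-sym (blocks-swap₂₃ β α γ)))) a∈S) a≢b a≢c)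
      (∈-blocks⁻ α γ β (∈-resp-↭ (↭-trans S↭ (↭-sym (blocks-swap₂₃ α β γ))) b∈S) (a≢b ∘ sym) b≢c)
      (∈-blocks⁻ α β γ (∈-resp-↭ S↭ c∈S) (a≢c ∘ sym) (b≢c ∘ sym)) } , S↭
  where
  ∈S : ∀ {x} → x ∈ a ∷ b ∷ c ∷ [] → x ∈ S
  ∈S {x} p = ∈-deduplicate⁻ _≟Pt_ S (subst (x ∈_) (sym eq) p)
  a∈S = ∈S (here refl)
  b∈S = ∈S (there (here refl))
  c∈S = ∈S (there (there (here refl)))

-- Symmetries of the square

Lin-negIf : ∀ s {x y z i j k} → Lin x y z i j k → Lin (negIf s x) (negIf s y) (negIf s z) i j k
Lin-negIf true = Lin-neg
Lin-negIf false e = e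

Lin-negIf⁻ : ∀ s {x y z i j k} → Lin (negIf s x) (negIf s y) (negIf s z) i j k → Lin x y z i j k
Lin-negIf⁻ true = Lin-neg⁻
Lin-negIf⁻ false e = e

Null-act : ∀ g {a b c i j k} → Null a b c i j k → Null (act g a) (act g b) (act g c) i j k
Null-act (true , s , t) (null e₁ e₂) = null (Lin-negIf s e₂) (Lin-negIf t e₁)
Null-act (false , s , t) (null e₁ e₂) = null (Lin-negIf s e₁) (Lin-negIf t e₂)

Null-act⁻ : ∀ g {a b c i j k} → Null (act g a) (act g b) (act g c) i j k → Null a b c i j k
Null-act⁻ (true , s , t) (null e₁ e₂) = null (Lin-negIf⁻ t e₂) (Lin-negIf⁻ s e₁)
Null-act⁻ (false , s , t) (null e₁ e₂) = null (Lin-negIf⁻ s e₁) (Lin-negIf⁻ t e₂)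

negIf-bounds : ∀ s {m x} → ℤ.- + m ℤ.≤ x × x ℤ.≤ + m → ℤ.- + m ℤ.≤ negIf s x × negIf s x ℤ.≤ + m
negIf-bounds true {m} {x} (l , r) = ℤ.neg-mono-≤ r , subst (ℤ.- x ℤ.≤_) (ℤ.neg-involutive (+ m)) (ℤ.neg-mono-≤ l)
negIf-bounds false p = p

InBox-act : ∀ g {m p} → InBox m p → InBox m (act g p)
InBox-act (true , s , t) (px , py) = negIf-bounds s py , negIf-bounds t px
InBox-act (false , s , t) (px , py) = negIf-bounds s px , negIf-bounds t py

negIf-xor : ∀ s t x → negIf s (negIf t x) ≡ negIf (s xor t) x
negIf-xor true true x = ℤ.neg-involutive x
negIf-xor true false x = refl
negIf-xor false t x = refl

-- The group law: an outer swap exchanges the coordinates that carry the inner signs. It merges the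
-- symmetry that normalises a corner with the one found in the equality case.
compose : Sym → Sym → Sym
compose (s , a , b) (t , c , d) = s xor t , a xor (if s then d else c) , b xor (if s then c else d)

act-compose : ∀ g h p → act g (act h p) ≡ act (compose g h) p
act-compose (true , a , b) (true , c , d) (x , y) = cong₂ _,_ (negIf-xor a d x) (negIf-xor b c y)
act-compose (true , a , b) (false , c , d) (x , y) = cong₂ _,_ (negIf-xor a d y) (negIf-xor b c x)
act-compose (false , a , b) (true , c , d) (x , y) = cong₂ _,_ (negIf-xor a c y) (negIf-xor b d x)
act-compose (false , a , b) (false , c , d) (x , y) = cong₂ _,_ (negIf-xor a c x) (negIf-xor b d y)

module _ {m a b c α β γ} (t : Triple m a b c α β γ) where
  open Triple t

  Triple-swap₁₂ : Triple m b a c β α γ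
  Triple-swap₁₂ = record { box-a = box-b ; box-b = box-a ; box-c = box-c
    ; minimal-null = Minimal-cong (Minimal-swap₁₂ minimal-null) Null-swap₁₂ Null-swap₁₂ }

  Triple-swap₂₃ : Triple m a c b α γ β
  Triple-swap₂₃ = record { box-a = box-a ; box-b = box-c ; box-c = box-b
    ; minimal-null = Minimal-cong (Minimal-swap₂₃ minimal-null) Null-swap₂₃ Null-swap₂₃ }

  Triple-act : ∀ g → Triple m (act g a) (act g b) (act g c) α β γ
  Triple-act g = record { box-a = InBox-act g box-a ; box-b = InBox-act g box-b ; box-c = InBox-act g box-c
    ; minimal-null = Minimal-cong minimal-null (Null-act g) (Null-act⁻ g) }

  Triple-not-antipodal : proj₁ a ≡ + m → proj₂ a ≡ + m → proj₁ b ≡ ℤ.- + m → proj₂ b ≢ ℤ.- + m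
  Triple-not-antipodal refl refl refl refl =
    ¬holds-ij0 minimal-null {1} {1} (Minimal.α>0 minimal-null) (Minimal.β>0 minimal-null) (λ ())
      (null (lin (lemma (+ m) (proj₁ c))) (lin (lemma (+ m) (proj₂ c))))
    where
    lemma : ∀ m z → + 1 ℤ.* m ℤ.+ (+ 1 ℤ.* (ℤ.- m) ℤ.+ 0ℤ ℤ.* z) ≡ 0ℤ
    lemma = ℤSolver.solve-∀

-- Pigeonhole among three vertices

OneOf TwoOf : (Pt → Set) → Pt → Pt → Pt → Set
OneOf P a b c = P a ⊎ P b ⊎ P c
TwoOf P a b c = (P a × P b) ⊎ (P a × P c) ⊎ (P b × P c)

module _ {P Q : Pt → Set} {a b c : Pt} where

  disjoint⇒twoOf : (∀ p → P p → ¬ Q p) → OneOf P a b c → OneOf Q a b c → TwoOf (λ p → P p ⊎ Q p) a b c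
  disjoint⇒twoOf dis (inj₁ p) (inj₁ q) = contradiction q (dis a p)
  disjoint⇒twoOf dis (inj₁ p) (inj₂ (inj₁ q)) = inj₁ (inj₁ p , inj₂ q)
  disjoint⇒twoOf dis (inj₁ p) (inj₂ (inj₂ q)) = inj₂ (inj₁ (inj₁ p , inj₂ q))
  disjoint⇒twoOf dis (inj₂ (inj₁ p)) (inj₁ q) = inj₁ (inj₂ q , inj₁ p)
  disjoint⇒twoOf dis (inj₂ (inj₁ p)) (inj₂ (inj₁ q)) = contradiction q (dis b p)
  disjoint⇒twoOf dis (inj₂ (inj₁ p)) (inj₂ (inj₂ q)) = inj₂ (inj₂ (inj₁ p , inj₂ q))
  disjoint⇒twoOf dis (inj₂ (inj₂ p)) (inj₁ q) = inj₂ (inj₁ (inj₂ q , inj₁ p))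
  disjoint⇒twoOf dis (inj₂ (inj₂ p)) (inj₂ (inj₁ q)) = inj₂ (inj₂ (inj₂ q , inj₁ p))
  disjoint⇒twoOf dis (inj₂ (inj₂ p)) (inj₂ (inj₂ q)) = contradiction q (dis c p)

  -- Two pairs chosen from three elements intersect.
  twoOf-meet : TwoOf P a b c → TwoOf Q a b c → OneOf (λ p → P p × Q p) a b c
  twoOf-meet (inj₁ (pa , pb)) (inj₁ (qa , qb)) = inj₁ (pa , qa)
  twoOf-meet (inj₁ (pa , pb)) (inj₂ (inj₁ (qa , qc))) = inj₁ (pa , qa)
  twoOf-meet (inj₁ (pa , pb)) (inj₂ (inj₂ (qb , qc))) = inj₂ (inj₁ (pb , qb))
  twoOf-meet (inj₂ (inj₁ (pa , pc))) (inj₁ (qa , qb)) = inj₁ (pa , qa)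
  twoOf-meet (inj₂ (inj₁ (pa , pc))) (inj₂ (inj₁ (qa , qc))) = inj₁ (pa , qa)
  twoOf-meet (inj₂ (inj₁ (pa , pc))) (inj₂ (inj₂ (qb , qc))) = inj₂ (inj₂ (pc , qc))
  twoOf-meet (inj₂ (inj₂ (pb , pc))) (inj₁ (qa , qb)) = inj₂ (inj₁ (pb , qb))
  twoOf-meet (inj₂ (inj₂ (pb , pc))) (inj₂ (inj₁ (qa , qc))) = inj₂ (inj₂ (pc , qc))
  twoOf-meet (inj₂ (inj₂ (pb , pc))) (inj₂ (inj₂ (qb , qc))) = inj₂ (inj₁ (pb , qb))

map-act-blocks : ∀ g {a b c} i j k → map (act g) (blocks a b c i j k) ≡ blocks (act g a) (act g b) (act g c) i j k
map-act-blocks g {a} {b} {c} i j k = trans (map-++ (act g) (replicate i a) _) (cong₂ _++_ (map-replicate (act g) i a)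
  (trans (map-++ (act g) (replicate j b) _) (cong₂ _++_ (map-replicate (act g) j b) (map-replicate (act g) k c))))

-- Bound and uniqueness travel together, so each reduction by permutation or symmetry is made once;
-- strictly shorter sequences satisfy `equality` vacuously.
record Bounded (m q : ℕ) (S : List Pt) : Set where
  constructor bounded
  field
    bound : length S + q ≤ 4 * m * m
    equality : length S + q ≡ 4 * m * m → ∃ λ g → map (act g) S ↭ extremal m q

module _ {m q : ℕ} where

  Bounded-↭ : ∀ {S S′} → S ↭ S′ → Bounded m q S′ → Bounded m q S
  Bounded-↭ {S} {S′} S↭S′ (bounded bound equality) = bounded
    (subst (λ l → l + q ≤ 4 * m * m) (sym (↭-length S↭S′)) bound)
    λ e → let g , r = equality (subst (λ l → l + q ≡ 4 * m * m) (↭-length S↭S′) e)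
          in g , ↭-trans (map⁺ (act g) S↭S′) r

  Bounded-act : ∀ h {a b c α β γ} → Triple m a b c α β γ → Bounded m q (blocks (act h a) (act h b) (act h c) α β γ) →
                Bounded m q (blocks a b c α β γ)
  Bounded-act h {a} {b} {c} {α} {β} {γ} _ B with subst (Bounded m q) (sym (map-act-blocks h α β γ)) B
  ... | bounded bound equality = bounded
    (subst (λ l → l + q ≤ 4 * m * m) (length-map (act h) S) bound)
    λ e → let g , r = equality (subst (λ l → l + q ≡ 4 * m * m) (sym (length-map (act h) S)) e)
          in compose g h , subst (_↭ extremal m q) (trans (sym (map-∘ S)) (map-cong (act-compose g h) S)) r
    where S = blocks a b c α β γ

  short⇒Bounded : ∀ {a b c α β γ} → Triple m a b c α β γ → α + β + γ + q < 4 * m * m → Bounded m q (blocks a b c α β γ)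
  short⇒Bounded {a} {b} {c} {α} {β} {γ} _ short = bounded (ℕ.<⇒≤ short′) (λ e → contradiction e (ℕ.<⇒≢ short′))
    where
    short′ : length (blocks a b c α β γ) + q < 4 * m * m
    short′ = subst (λ l → l + q < 4 * m * m) (sym (length-blocks α β γ)) short

-- Triangles with a vertex at the corner (m, m)

-m+u′≡m-u : ∀ {m u u′} → u + u′ ≡ m + m → ℤ.- + m ℤ.+ + u′ ≡ + m ℤ.- + u
-m+u′≡m-u {m} {u} {u′} e = begin
  ℤ.- + m ℤ.+ + u′                     ≡⟨ lemma₁ (+ m) (+ u) (+ u′) ⟩
  ℤ.- + m ℤ.+ (+ u ℤ.+ + u′) ℤ.- + u   ≡⟨ cong (λ n → ℤ.- + m ℤ.+ + n ℤ.- + u) e ⟩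
  ℤ.- + m ℤ.+ (+ m ℤ.+ + m) ℤ.- + u    ≡⟨ lemma₂ (+ m) (+ u) ⟩
  + m ℤ.- + u                          ∎
  where
  open ≡-Reasoning
  lemma₁ : ∀ m u u′ → ℤ.- m ℤ.+ u′ ≡ ℤ.- m ℤ.+ (u ℤ.+ u′) ℤ.- u
  lemma₁ = ℤSolver.solve-∀
  lemma₂ : ∀ m u → ℤ.- m ℤ.+ (m ℤ.+ m) ℤ.- u ≡ m ℤ.- u
  lemma₂ = ℤSolver.solve-∀

-- The triangle with vertices (m , m), (- m , m - v), (m - u , - m), where u = 2 m - u′ and v = 2 m - v′.
cornerBlocks : (m u′ v′ α β γ : ℕ) → List Pt
cornerBlocks m u′ v′ = blocks (+ m , + m) (ℤ.- + m , ℤ.- + m ℤ.+ + v′) (ℤ.- + m ℤ.+ + u′ , ℤ.- + m)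

-- The stated multiplicities are the determinants for u = q and v = 1; the equations in the
-- hypotheses replace truncated subtraction.
extremal≡cornerBlocks : ∀ {m q u′ v′ α} → 0 < m → q + u′ ≡ m + m → 1 + v′ ≡ m + m → α + q ≡ m * (q + 1) →
  extremal m q ≡ cornerBlocks m u′ v′ α (m * u′) (m * v′)
extremal≡cornerBlocks {m@(suc n)} {q} {u′} {v′} {α} _ eu ev eα = begin
  extremal m q
    ≡⟨ cong₂ (λ y x → blocks (+ m , + m) (ℤ.- + m , y) (x , ℤ.- + m) (q * n + m) (2 * m * m ∸ m * q) (2 * m * m ∸ m))
         (-m+u′≡m-u {m} {1} {v′} ev) (-m+u′≡m-u {m} {q} {u′} eu) ⟨
  cornerBlocks m u′ v′ (q * n + m) (2 * m * m ∸ m * q) (2 * m * m ∸ m)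
    ≡⟨ cong₂ (cornerBlocks m u′ v′ (q * n + m)) (complement q u′ eu)
         (trans (complement 1 v′ ev) (cong (2 * m * m ∸_) (ℕ.*-identityʳ m))) ⟨
  cornerBlocks m u′ v′ (q * n + m) (m * u′) (m * v′)
    ≡⟨ cong (λ i → cornerBlocks m u′ v′ i (m * u′) (m * v′)) α≡ ⟨
  cornerBlocks m u′ v′ α (m * u′) (m * v′) ∎
  where
  open ≡-Reasoning
  α≡ : α ≡ q * n + suc n
  α≡ = ℕ.+-cancelʳ-≡ q α (q * n + suc n) (trans eα (lemma n q))
    where
    lemma : ∀ n q → suc n * (q + 1) ≡ q * n + suc n + q
    lemma = ℕSolver.solve-∀
  complement : ∀ u u′ → u + u′ ≡ m + m → m * u′ ≡ 2 * m * m ∸ m * u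
  complement u u′ e = sym (trans (cong (_∸ m * u) (begin
    2 * m * m        ≡⟨ lemma₁ m ⟩
    m * (m + m)      ≡⟨ cong (m *_) e ⟨
    m * (u + u′)     ≡⟨ lemma₂ m u u′ ⟩
    m * u′ + m * u   ∎)) (ℕ.m+n∸n≡m (m * u′) (m * u)))
    where
    lemma₁ : ∀ m → 2 * m * m ≡ m * (m + m)
    lemma₁ = ℕSolver.solve-∀
    lemma₂ : ∀ m u u′ → m * (u + u′) ≡ m * u′ + m * u
    lemma₂ = ℕSolver.solve-∀

module _ (m u′ v′ : ℕ) where

  private
    a b c : Pt
    a = (+ m , + m)
    b = (ℤ.- + m , ℤ.- + m ℤ.+ + v′)
    c = (ℤ.- + m ℤ.+ + u′ , ℤ.- + m)

  corner-det-ab : det a b ≡ + (m * v′)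
  corner-det-ab = trans (lemma (+ m) (+ v′)) (sym (ℤ.pos-* m v′))
    where
    lemma : ∀ m v → m ℤ.* (ℤ.- m ℤ.+ v) ℤ.- m ℤ.* (ℤ.- m) ≡ m ℤ.* v
    lemma = ℤSolver.solve-∀

  corner-det-ca : det c a ≡ + (m * u′)
  corner-det-ca = trans (lemma (+ m) (+ u′)) (sym (ℤ.pos-* m u′))
    where
    lemma : ∀ m u → (ℤ.- m ℤ.+ u) ℤ.* m ℤ.- (ℤ.- m) ℤ.* m ≡ m ℤ.* u
    lemma = ℤSolver.solve-∀

  corner-det-bc : ∀ {u v} → u + u′ ≡ m + m → v + v′ ≡ m + m → det b c ℤ.+ + (u * v) ≡ + (m * (u + v))
  corner-det-bc {u} {v} eu ev = begin
    det b c ℤ.+ + (u * v)                  ≡⟨ cong₂ (λ x y → (ℤ.- + m ℤ.* ℤ.- + m ℤ.- y ℤ.* x) ℤ.+ + (u * v)) (-m+u′≡m-u {m} {u} {u′} eu) (-m+u′≡m-u {m} {v} {v′} ev) ⟩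
    (ℤ.- + m ℤ.* ℤ.- + m ℤ.- (+ m ℤ.- + v) ℤ.* (+ m ℤ.- + u)) ℤ.+ + (u * v)
                                           ≡⟨ cong (λ z → (ℤ.- + m ℤ.* ℤ.- + m ℤ.- (+ m ℤ.- + v) ℤ.* (+ m ℤ.- + u)) ℤ.+ z) (ℤ.pos-* u v) ⟩
    (ℤ.- + m ℤ.* ℤ.- + m ℤ.- (+ m ℤ.- + v) ℤ.* (+ m ℤ.- + u)) ℤ.+ + u ℤ.* + v
                                           ≡⟨ lemma (+ m) (+ u) (+ v) ⟩
    + m ℤ.* (+ u ℤ.+ + v)                  ≡⟨ ℤ.pos-* m (u + v) ⟨
    + (m * (u + v))                        ∎
    where
    open ≡-Reasoning
    lemma : ∀ m u v → (ℤ.- m ℤ.* ℤ.- m ℤ.- (m ℤ.- v) ℤ.* (m ℤ.- u)) ℤ.+ u ℤ.* v ≡ m ℤ.* (u ℤ.+ v)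
    lemma = ℤSolver.solve-∀

-- The upper bound, its equality case and the extremal sequence

module _ {m q : ℕ} (2≤m : 2 ≤ m) (isQ : IsQ m q) where

  private
    q≤1+m = IsQ⇒q≤1+m 2≤m isQ
    instance
      _ = >-nonZero (ℕ.<-trans z<s 2≤m)
      _ = prime⇒nonZero (proj₁ isQ)

  scale0⇒short : ∀ {a b c α β γ} (t : Triple m a b c α β γ) →
    det c a ≡ 0ℤ → det a b ≡ 0ℤ → α + β + γ + q < 4 * m * m
  scale0⇒short t eca eab = collinear-short 2≤m q≤1+m
    (collinear-length (Triple.box-a t) (Triple.box-b t) (Triple.box-c t) eab eca (Triple.minimal-null t))

  OnRight : Pt → Set
  OnRight p = proj₁ p ≡ + m

  -- A triangle missing the right side fits into a rectangle of width 2 m - 1 and height 2 m, and a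
  -- nonzero integer scale makes the length at most the double area. The other sides follow by
  -- symmetry.
  right-reached : ∀ {a b c α β γ} → Triple m a b c α β γ → α + β + γ + q < 4 * m * m ⊎ OneOf OnRight a b c
  right-reached {a} {b} {c} {α} {β} {γ} t
    with proj₁ a ℤ.≟ + m | proj₁ b ℤ.≟ + m | proj₁ c ℤ.≟ + m
  ... | yes p | _ | _ = inj₂ (inj₁ p)
  ... | no _ | yes p | _ = inj₂ (inj₂ (inj₁ p))
  ... | no _ | no _ | yes p = inj₂ (inj₂ (inj₂ p))
  ... | no a≢ | no b≢ | no c≢ with Null-minimal⇒scaled (Triple.minimal-null t)
  ... | record { scale = g ; det-bc = ebc ; det-ca = eca ; det-ab = eab } with g ℤ.≟ 0ℤ
  ... | yes refl = inj₁ (scale0⇒short t eca eab)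
  ... | no g≢0 = inj₁ (narrow-short 2≤m q≤1+m (ℕ.suc-pred m) (begin
      α + β + γ              ≤⟨ ℕ.m≤n*m (α + β + γ) ∣ g ∣ ⟩
      ∣ g ∣ * (α + β + γ)    ≡⟨ ℤ.abs-* g (+ (α + β + γ)) ⟨
      ∣ g ℤ.* + (α + β + γ) ∣  ≡⟨ cong ∣_∣ area≡ ⟨
      ∣ area a b c ∣         ≤⟨ area≤w*h (ℤ.- + m) (ℤ.- + m)
                                  (narrow (Triple.box-a t) a≢) (narrow (Triple.box-b t) b≢) (narrow (Triple.box-c t) c≢) ⟩
      (m + pred m) * (m + m)  ∎))
    where
    open ℕ.≤-Reasoning
    instance _ = ≢-nonZero (λ e → g≢0 (ℤ.∣i∣≡0⇒i≡0 e))
    area≡ : area a b c ≡ g ℤ.* + (α + β + γ)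
    area≡ = trans (cong₂ ℤ._+_ (cong₂ ℤ._+_ ebc eca) eab) (lemma g (+ α) (+ β) (+ γ))
      where
      lemma : ∀ g α β γ → g ℤ.* α ℤ.+ g ℤ.* β ℤ.+ g ℤ.* γ ≡ g ℤ.* (α ℤ.+ β ℤ.+ γ)
      lemma = ℤSolver.solve-∀
    cancel : ∀ m n → n ≡ ℤ.- m ℤ.+ (m ℤ.+ n)
    cancel = ℤSolver.solve-∀
    <⇒≤pred : ∀ {x} n .{{_ : NonZero n}} → x ℤ.< + n → x ℤ.≤ + pred n
    <⇒≤pred (suc n) x<n = ℤ.i<j⇒i≤pred[j] x<n
    narrow : ∀ {p} → InBox m p → ¬ OnRight p → Inside (ℤ.- + m) (ℤ.- + m) {m + pred m} {m + m} p
    narrow {p} ((l , r) , (d , u)) x≢ =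
      (l , ℤ.≤-trans (<⇒≤pred m (ℤ.≤∧≢⇒< r x≢)) (ℤ.≤-reflexive (cancel (+ m) (+ pred m)))) ,
      (d , ℤ.≤-trans u (ℤ.≤-reflexive (cancel (+ m) (+ m))))

  cornerBlocks-bounded : ∀ {u′ v′ α β γ} → u′ ≤ m + m → v′ ≤ m + m →
    Triple m (+ m , + m) (ℤ.- + m , ℤ.- + m ℤ.+ + v′) (ℤ.- + m ℤ.+ + u′ , ℤ.- + m) α β γ →
    Bounded m q (cornerBlocks m u′ v′ α β γ)
  cornerBlocks-bounded {u′} {v′} {α} {β} {γ} u′≤ v′≤ t with ℕ.m≤n⇒∃[o]m+o≡n u′≤ | ℕ.m≤n⇒∃[o]m+o≡n v′≤
  ... | u , u′+u | v , v′+v = go (Null-minimal⇒scaled (Triple.minimal-null t))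
    where
    a b c : Pt
    a = (+ m , + m)
    b = (ℤ.- + m , ℤ.- + m ℤ.+ + v′)
    c = (ℤ.- + m ℤ.+ + u′ , ℤ.- + m)
    eu : u + u′ ≡ m + m
    eu = trans (ℕ.+-comm u u′) u′+u
    ev : v + v′ ≡ m + m
    ev = trans (ℕ.+-comm v v′) v′+v
    unit-scale : α + u * v ≡ m * (u + v) → β ≡ m * u′ → γ ≡ m * v′ → Bounded m q (cornerBlocks m u′ v′ α β γ)
    unit-scale eα refl refl = bounded
      (subst (λ l → l + q ≤ 4 * m * m) (sym len) (ℕ.≤-trans (ℕ.+-monoʳ-≤ L q≤uv) (ℕ.≤-reflexive L+uv)))
      (λ e → equality (subst (λ l → l + q ≡ 4 * m * m) len e))
      where
      L = α + m * u′ + m * v′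
      len : length (cornerBlocks m u′ v′ α (m * u′) (m * v′)) ≡ L
      len = length-blocks α (m * u′) (m * v′)
      L+uv : L + u * v ≡ 4 * m * m
      L+uv = trans (cong (_+ u * v) (sym (ℕ.*-identityˡ L))) (corner-sum {m} {1} {u} {u′} {v} {v′} eu ev
        (trans (cong (_+ u * v) (ℕ.*-identityˡ α)) eα) (ℕ.*-identityˡ (m * u′)) (ℕ.*-identityˡ (m * v′)))
      q≤uv : q ≤ u * v
      q≤uv = q≤u*v 2≤m isQ eu ev eα refl refl (Null-minimal⇒coprime (Triple.minimal-null t))
      equality : L + q ≡ 4 * m * m → ∃ λ g → map (act g) (cornerBlocks m u′ v′ α (m * u′) (m * v′)) ↭ extremal m q
      equality e = factors
        where
        uv≡q : u * v ≡ q
        uv≡q = ℕ.+-cancelˡ-≡ L (u * v) q (trans L+uv (sym e))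
        m>0 = ℕ.<-trans z<s 2≤m
        αq≡ : u + v ≡ q + 1 → α + q ≡ m * (q + 1)
        αq≡ s = trans (cong (_+_ α) (sym uv≡q)) (trans eα (cong (m *_) s))
        factors : ∃ λ g → map (act g) (cornerBlocks m u′ v′ α (m * u′) (m * v′)) ↭ extremal m q
        factors with prime⇒irreducible (proj₁ isQ) (subst (u ∣_) uv≡q (m∣m*n v))
        -- The reflection (x, y) ↦ (y, x) fixes (m, m) and exchanges the roles of u and v, so this
        -- is the mirror image of the case u = q.
        ... | inj₁ u≡1 = (true , false , false) , ↭-trans
          (↭-reflexive (map-act-blocks (true , false , false) α (m * u′) (m * v′)))
          (↭-trans (blocks-swap₂₃ α (m * v′) (m * u′))
            (↭-reflexive (sym (extremal≡cornerBlocks m>0 (subst (λ n → n + v′ ≡ m + m) v≡q ev)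
              (subst (λ n → n + u′ ≡ m + m) u≡1 eu) (αq≡ (trans (ℕ.+-comm u v) (cong₂ _+_ v≡q u≡1)))))))
          where
          v≡q : v ≡ q
          v≡q = trans (sym (trans (cong (_* v) u≡1) (ℕ.*-identityˡ v))) uv≡q
        ... | inj₂ u≡q = (false , false , false) ,
          ↭-reflexive (trans (map-act-blocks (false , false , false) α (m * u′) (m * v′))
            (sym (extremal≡cornerBlocks m>0 (subst (λ n → n + u′ ≡ m + m) u≡q eu)
              (subst (λ n → n + v′ ≡ m + m) v≡1 ev) (αq≡ (cong₂ _+_ u≡q v≡1)))))
          where
          v≡1 : v ≡ 1
          v≡1 = ℕ.*-cancelˡ-≡ v 1 q (trans (cong (_* v) (sym u≡q)) (trans uv≡q (sym (ℕ.*-identityʳ q))))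
    go : Scaled a b c α β γ → Bounded m q (cornerBlocks m u′ v′ α β γ)
    -- The vertices are listed so that det(a,b) = m v′ ≥ 0, whereas γ > 0 would make it negative.
    go record { scale = -[1+ n ] ; det-ab = eab } = contradiction
      (trans (sym eab) (corner-det-ab m u′ v′)) (negative γ (Minimal.γ>0 (Triple.minimal-null t)))
      where
      negative : ∀ {k} γ → 0 < γ → -[1+ n ] ℤ.* + γ ≢ + k
      negative (suc γ) _ ()
    go record { scale = + 0 ; det-ca = eca ; det-ab = eab } = short⇒Bounded t (scale0⇒short t eca eab)
    go record { scale = + n@(suc _) ; det-bc = ebc ; det-ca = eca ; det-ab = eab } = cases n refl
      where
      nβ : n * β ≡ m * u′
      nβ = ℤ.+-injective (trans (ℤ.pos-* n β) (trans (sym eca) (corner-det-ca m u′ v′)))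
      nγ : n * γ ≡ m * v′
      nγ = ℤ.+-injective (trans (ℤ.pos-* n γ) (trans (sym eab) (corner-det-ab m u′ v′)))
      nα : n * α + u * v ≡ m * (u + v)
      nα = ℤ.+-injective (trans (cong (λ z → z ℤ.+ + (u * v)) (trans (ℤ.pos-* n α) (sym ebc))) (corner-det-bc m u′ v′ eu ev))
      cases : ∀ k → k ≡ n → Bounded m q (cornerBlocks m u′ v′ α β γ)
      cases 1 refl = unit-scale (trans (cong (_+ u * v) (sym (ℕ.*-identityˡ α))) nα)
        (trans (sym (ℕ.*-identityˡ β)) nβ) (trans (sym (ℕ.*-identityˡ γ)) nγ)
      cases (suc (suc k)) refl = short⇒Bounded t (half-short 2≤m q≤1+m {α + β + γ} (begin
        2 * (α + β + γ)                 ≤⟨ ℕ.*-monoˡ-≤ (α + β + γ) {2} {n} (s≤s (s≤s z≤n)) ⟩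
        n * (α + β + γ)                 ≤⟨ ℕ.m≤m+n (n * (α + β + γ)) (u * v) ⟩
        n * (α + β + γ) + u * v         ≡⟨ corner-sum {m} {n} {u} {u′} {v} {v′} {α} {β} {γ} eu ev nα nβ nγ ⟩
        4 * m * m                       ∎))
        where open ℕ.≤-Reasoning

  corner-bounded : ∀ {x y α β γ} → Triple m (+ m , + m) (ℤ.- + m , y) (x , ℤ.- + m) α β γ →
    Bounded m q (blocks (+ m , + m) (ℤ.- + m , y) (x , ℤ.- + m) α β γ)
  corner-bounded t with Triple.box-b t | Triple.box-c t
  ... | _ , (d , u) | (l , r) , _ with between (m + m) l (reach r) | between (m + m) d (reach u)
    where
    reach : ∀ {x} → x ℤ.≤ + m → x ℤ.≤ ℤ.- + m ℤ.+ + (m + m)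
    reach r = ℤ.≤-trans r (ℤ.≤-reflexive (lemma (+ m)))
      where
      lemma : ∀ m → m ≡ ℤ.- m ℤ.+ (m ℤ.+ m)
      lemma = ℤSolver.solve-∀
  ... | u′ , u′≤ , refl | v′ , v′≤ , refl = cornerBlocks-bounded u′≤ v′≤ t

  m≢-m : + m ≢ ℤ.- + m
  m≢-m = lemma m
    where
    lemma : ∀ m .{{_ : NonZero m}} → + m ≢ ℤ.- + m
    lemma (suc _) ()

  neg-flip : ∀ {x} → ℤ.- x ≡ + m → x ≡ ℤ.- + m
  neg-flip {x} e = trans (sym (ℤ.neg-involutive x)) (cong ℤ.-_ e)

  OnLeft OnTop OnBottom : Pt → Set
  OnLeft p = proj₁ p ≡ ℤ.- + m
  OnTop p = proj₂ p ≡ + m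
  OnBottom p = proj₂ p ≡ ℤ.- + m

  module _ {a b c α β γ} (t : Triple m a b c α β γ) where

    left-reached : α + β + γ + q < 4 * m * m ⊎ OneOf OnLeft a b c
    left-reached = Sum.map₂ (Sum.map neg-flip (Sum.map neg-flip neg-flip)) (right-reached (Triple-act t (false , true , false)))

    top-reached : α + β + γ + q < 4 * m * m ⊎ OneOf OnTop a b c
    top-reached = right-reached (Triple-act t (true , false , false))

    bottom-reached : α + β + γ + q < 4 * m * m ⊎ OneOf OnBottom a b c
    bottom-reached = Sum.map₂ (Sum.map neg-flip (Sum.map neg-flip neg-flip)) (right-reached (Triple-act t (true , true , false)))

  -- (m, m) is on neither the left nor the bottom side, and a vertex on both would be its antipode.
  -- So `b` and `c` take these two sides, one each.
  topRight-bounded : ∀ {b c α β γ} → Triple m (+ m , + m) b c α β γ → Bounded m q (blocks (+ m , + m) b c α β γ)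
  topRight-bounded {b} {c} {α} {β} {γ} t with left-reached t | bottom-reached t
  ... | inj₁ short | _ = short⇒Bounded t short
  ... | inj₂ _ | inj₁ short = short⇒Bounded t short
  ... | inj₂ (inj₁ e) | inj₂ _ = contradiction e m≢-m
  ... | inj₂ (inj₂ _) | inj₂ (inj₁ e) = contradiction e m≢-m
  ... | inj₂ (inj₂ (inj₁ bx)) | inj₂ (inj₂ (inj₁ by)) = contradiction by (Triple-not-antipodal t refl refl bx)
  ... | inj₂ (inj₂ (inj₂ cx)) | inj₂ (inj₂ (inj₂ cy)) = contradiction cy (Triple-not-antipodal (Triple-swap₂₃ t) refl refl cx)
  ... | inj₂ (inj₂ (inj₁ refl)) | inj₂ (inj₂ (inj₂ refl)) = corner-bounded t
  ... | inj₂ (inj₂ (inj₂ refl)) | inj₂ (inj₂ (inj₁ refl)) =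
    Bounded-↭ (↭-sym (blocks-swap₂₃ α β γ)) (corner-bounded (Triple-swap₂₃ t))

  Corner : Pt → Set
  Corner p = (OnRight p ⊎ OnLeft p) × (OnTop p ⊎ OnBottom p)

  firstCorner-bounded : ∀ {a b c α β γ} → Triple m a b c α β γ → Corner a → Bounded m q (blocks a b c α β γ)
  firstCorner-bounded {a} {b} {c} {α} {β} {γ} t (px , py) =
    Bounded-act g t (subst (λ p → Bounded m q (blocks p (act g b) (act g c) α β γ)) (sym ga≡)
      (topRight-bounded (subst (λ p → Triple m p (act g b) (act g c) α β γ) ga≡ (Triple-act t g))))
    where
    towards : ∀ {x} → x ≡ + m ⊎ x ≡ ℤ.- + m → ∃ λ s → negIf s x ≡ + m
    towards (inj₁ e) = false , e
    towards (inj₂ refl) = true , ℤ.neg-involutive (+ m)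
    g : Sym
    g = false , proj₁ (towards px) , proj₁ (towards py)
    ga≡ : act g a ≡ (+ m , + m)
    ga≡ = cong₂ _,_ (proj₂ (towards px)) (proj₂ (towards py))

  triple-bounded : ∀ {a b c α β γ} → Triple m a b c α β γ → Bounded m q (blocks a b c α β γ)
  triple-bounded {a} {b} {c} {α} {β} {γ} t with right-reached t | left-reached t | top-reached t | bottom-reached t
  ... | inj₁ short | _ | _ | _ = short⇒Bounded t short
  ... | inj₂ _ | inj₁ short | _ | _ = short⇒Bounded t short
  ... | inj₂ _ | inj₂ _ | inj₁ short | _ = short⇒Bounded t short
  ... | inj₂ _ | inj₂ _ | inj₂ _ | inj₁ short = short⇒Bounded t short
  ... | inj₂ right | inj₂ left | inj₂ top | inj₂ bottom
    with twoOf-meet {OnRight ∪ OnLeft} {OnTop ∪ OnBottom} {a} {b} {c}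
           (disjoint⇒twoOf {OnRight} {OnLeft} {a} {b} {c} (λ p r l → m≢-m (trans (sym r) l)) right left)
           (disjoint⇒twoOf {OnTop} {OnBottom} {a} {b} {c} (λ p r l → m≢-m (trans (sym r) l)) top bottom)
  ... | inj₁ corner = firstCorner-bounded t corner
  ... | inj₂ (inj₁ corner) = Bounded-↭ (↭-sym (blocks-swap₁₂ α β γ)) (firstCorner-bounded (Triple-swap₁₂ t) corner)
  ... | inj₂ (inj₂ corner) = Bounded-↭ (↭-sym (↭-trans (blocks-swap₁₂ α γ β) (blocks-swap₂₃ α β γ)))
    (firstCorner-bounded (Triple-swap₁₂ (Triple-swap₂₃ t)) corner)

  admissible-bounded : ∀ S → Admissible m S → Bounded m q S
  admissible-bounded S adm with admissible⇒triple adm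
  ... | _ , _ , _ , _ , _ , _ , t , S↭ = Bounded-↭ S↭ (triple-bounded t)

  extremal-admissible : Admissible m (extremal m q) × length (extremal m q) + q ≡ 4 * m * m
  extremal-admissible with ℕ.m≤n⇒∃[o]m+o≡n q<2m | ℕ.m≤n⇒∃[o]m+o≡n 1<2m
    where
    1<2m : 1 < m + m
    1<2m = ℕ.≤-trans 2≤m (ℕ.m≤m+n m m)
    q<2m : q < m + m
    q<2m = ℕ.≤-trans (s≤s q≤1+m) (ℕ.+-monoˡ-≤ m 2≤m)
  -- Here `u` and `v` are the predecessors of u′ = 2 m - q and v′ = 2 m - 1, which makes the
  -- positivity of these two visible.
  ... | u , 1+q+u | v , 2+v = subst (λ S → Admissible m S × length S + q ≡ 4 * m * m)
      (sym (extremal≡cornerBlocks m>0 eu 2+v eα)) ((boxes , Minimal⇒MinimalZeroSum minimal , support) , len)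
    where
    m>0 = ℕ.<-trans z<s 2≤m
    u′ = suc u
    v′ = suc v
    α = q * pred m + m
    a b c : Pt
    a = (+ m , + m)
    b = (ℤ.- + m , ℤ.- + m ℤ.+ + v′)
    c = (ℤ.- + m ℤ.+ + u′ , ℤ.- + m)
    eu : q + u′ ≡ m + m
    eu = trans (ℕ.+-suc q u) 1+q+u
    eα : α + q ≡ m * (q + 1)
    eα = trans (lemma q (pred m) m) (trans (cong (λ n → q * n + m) (ℕ.suc-pred m)) (lemma′ q m))
      where
      lemma : ∀ q n m → q * n + m + q ≡ q * suc n + m
      lemma = ℕSolver.solve-∀
      lemma′ : ∀ q m → q * m + m ≡ m * (q + 1)
      lemma′ = ℕSolver.solve-∀
    α>0 : 0 < α
    α>0 = ℕ.<-≤-trans m>0 (ℕ.m≤n+m m (q * pred m))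
    positive : ∀ n → 0 < m * suc n
    positive n = ℕ.<-≤-trans m>0 (ℕ.m≤m*n m (suc n))
    coprime : Coprime₃ α (m * u′) (m * v′)
    coprime = extremal-coprime isQ eu 2+v eα
    ebc : det b c ≡ + α
    ebc = ℤ-+.∙-cancelʳ (+ (q * 1)) (det b c) (+ α) (trans (corner-det-bc m u′ v′ eu 2+v)
      (cong +_ (trans (sym eα) (cong (_+_ α) (sym (ℕ.*-identityʳ q))))))
    minimal : Minimal (Null a b c) α (m * u′) (m * v′)
    minimal = scaled⇒minimal α>0 (positive u) (positive v) coprime ebc (corner-det-ca m u′ v′) (corner-det-ab m u′ v′)
    -- The support has three elements because the determinant of two equal points vanishes.
    distinct : ∀ {p r n} → 0 < n → det p r ≡ + n → p ≢ r
    distinct {p} n>0 e refl = ℕ.<⇒≢ n>0 (ℤ.+-injective (trans (sym (lemma (proj₁ p) (proj₂ p))) e))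
      where
      lemma : ∀ x y → x ℤ.* y ℤ.- y ℤ.* x ≡ 0ℤ
      lemma = ℤSolver.solve-∀
    support : supportSize (blocks a b c α (m * u′) (m * v′)) ≡ 3
    support = cong length (deduplicate-blocks _≟Pt_
      (distinct (positive v) (corner-det-ab m u′ v′))
      (λ a≡c → distinct (positive u) (corner-det-ca m u′ v′) (sym a≡c))
      (distinct α>0 ebc) α>0 (positive u) (positive v))
    -m≤m : ℤ.- + m ℤ.≤ + m
    -m≤m = ℤ.neg-≤-pos {m} {m}
    inside : ∀ {n} → n ≤ m + m → ℤ.- + m ℤ.≤ ℤ.- + m ℤ.+ + n × ℤ.- + m ℤ.+ + n ℤ.≤ + m
    inside {n} n≤ = ℤ.i≤i+j (ℤ.- + m) (+ n) ,
      ℤ.≤-trans (ℤ.+-monoʳ-≤ (ℤ.- + m) (ℤ.+≤+ n≤)) (ℤ.≤-reflexive (lemma (+ m)))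
      where
      lemma : ∀ m → ℤ.- m ℤ.+ (m ℤ.+ m) ≡ m
      lemma = ℤSolver.solve-∀
    boxes : All (InBox m) (blocks a b c α (m * u′) (m * v′))
    boxes = All.++⁺ (All.replicate⁺ α ((-m≤m , ℤ.≤-refl) , (-m≤m , ℤ.≤-refl)))
      (All.++⁺ (All.replicate⁺ (m * u′) ((ℤ.≤-refl , -m≤m) , inside (ℕ.≤-trans (ℕ.n≤1+n v′) (ℕ.≤-reflexive 2+v))))
        (All.replicate⁺ (m * v′) (inside (ℕ.≤-trans (ℕ.m≤n+m u′ q) (ℕ.≤-reflexive eu)) , (ℤ.≤-refl , -m≤m))))
    len : length (blocks a b c α (m * u′) (m * v′)) + q ≡ 4 * m * m
    len = trans (cong₂ _+_ (trans (length-blocks α (m * u′) (m * v′)) (sym (ℕ.*-identityˡ _))) (sym (ℕ.*-identityʳ q)))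
      (corner-sum {m} {1} {q} {u′} {1} {v′} eu 2+v
        (trans (cong₂ _+_ (ℕ.*-identityˡ α) (ℕ.*-identityʳ q)) eα) (ℕ.*-identityˡ (m * u′)) (ℕ.*-identityˡ (m * v′)))

theorem3 : (m q : ℕ) → 2 ≤ m → IsQ m q →
    (Admissible m (extremal m q) × length (extremal m q) + q ≡ 4 * m * m)
    × (∀ (S : List Pt) → Admissible m S → length S + q ≤ 4 * m * m)
    × (∀ (S : List Pt) → Admissible m S → length S + q ≡ 4 * m * m →
    ∃ λ (g : Sym) → map (act g) S ↭ extremal m q)
theorem3 m q 2≤m isQ = extremal-admissible 2≤m isQ ,
  (λ S adm → Bounded.bound (admissible-bounded 2≤m isQ S adm)) ,
  (λ S adm → Bounded.equality (admissible-bounded 2≤m isQ S adm))
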